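{- Let $n\ge 1$, $k\ge 0$ and $\ell\ge 1$ be integers with $\ell\le k+1$. Consider families $\mathcal{F}\subset 2^{[n]}$ such that there are no two sets $A,B\in\mathcal{F}$ satisfying $A\subset B$ and $|B\setminus A|>k$. Among such families, the ones containing the most $\ell$-chains are $$\left\{F\subset[n] : \left\lfloor\tfrac{n-k}{2}\right\rfloor\le|F|\le\left\lfloor\tfrac{n+k}{2}\right\rfloor\right\}\quad\text{and}\quad\left\{F\subset[n] : \left\lceil\tfrac{n-k}{2}\right\rceil\le|F|\le\left\lceil\tfrac{n+k}{2}\right\rceil\right\}.$$ (These two families are the same if $n+k$ is even.)
   Context: $[n]=\{1,2,\dots,n\}$ and $2^{[n]}$ is the family of all subsets of $[n]$. An $\ell$-chain is a family $\{G_1,\dots,G_\ell\}$ of $\ell$ distinct subsets of $[n]$ with $G_1\subset G_2\subset\dots\subset G_\ell$; a family $\mathcal{F}$ contains the $\ell$-chain if $\{G_1,\dots,G_\ell\}\subset\mathcal{F}$.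
   Formalization: That no other family attains the maximum is claimed only for ℓ ≤ n+1; for ℓ > n+1 there are no ℓ-chains in 2^[n], so all families tie at 0 (e.g. n=1, k=2, ℓ=3) and uniqueness fails. -}

module Defs where

open import Data.Bool using (Bool; T)
open import Data.Bool.Properties using (T?)
open import Data.Fin.Subset using (Subset; inside; outside; _⊆_; _⊂_; _─_; ∣_∣)
open import Data.Fin.Subset.Properties using (_⊂?_)
open import Data.Integer as ℤ using (ℤ; +_)
open import Data.List using (List; []; _∷_; [_]; length; filter; cartesianProductWith)
open import Data.Nat using (ℕ; zero; suc; _≤_; _>_)
open import Data.Product using (_×_)
open import Data.Vec using (Vec; []; _∷_)
open import Data.Vec.Relation.Unary.All using (All; all?)
open import Data.Vec.Relation.Unary.Linked using (Linked; linked?)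
open import Relation.Nullary using (¬_; Dec; does)
open import Relation.Nullary.Decidable using (_×-dec_)

-- A family of subsets of [n] is given by its characteristic function, just as
-- Subset n = Vec Bool n; two families are equal when they agree pointwise (_≗_).
Family : ℕ → Set
Family n = Subset n → Bool

infix 4 _∈ᶠ_

_∈ᶠ_ : ∀ {n} → Subset n → Family n → Set
G ∈ᶠ F = T (F G)

-- A family of ℓ distinct sets that is totally ordered by inclusion can be listed
-- in exactly one way as G₁ ⊂ G₂ ⊂ … ⊂ G_ℓ, so ℓ-chains are represented by strictly
-- increasing sequences (_⊂_ is strict inclusion), and each is counted once.
IsChain : ∀ {n ℓ} → Vec (Subset n) ℓ → Set
IsChain = Linked _⊂_

_ContainsChain_ : ∀ {n ℓ} → Family n → Vec (Subset n) ℓ → Set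
F ContainsChain Gs = IsChain Gs × All (_∈ᶠ F) Gs

containsChain? : ∀ {n ℓ} (F : Family n) (Gs : Vec (Subset n) ℓ) → Dec (F ContainsChain Gs)
containsChain? F Gs = linked? _⊂?_ Gs ×-dec all? (λ G → T? (F G)) Gs

-- All vectors of length m with entries from xs; there are no repetitions if xs has none.
vectors : ∀ {A : Set} → List A → (m : ℕ) → List (Vec A m)
vectors xs zero    = [ [] ]
vectors xs (suc m) = cartesianProductWith _∷_ xs (vectors xs m)

allSubsets : (n : ℕ) → List (Subset n)
allSubsets n = vectors (outside ∷ inside ∷ []) n

#chains : ∀ {n} (ℓ : ℕ) → Family n → ℕ
#chains {n} ℓ F = length (filter (containsChain? F) (vectors (allSubsets n) ℓ))

Admissible : ∀ {n} (k : ℕ) → Family n → Set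
Admissible k F = ∀ A B → A ∈ᶠ F → B ∈ᶠ F → ¬ (A ⊆ B × ∣ B ─ A ∣ > k)

ContainsMostChains : ∀ {n} (k ℓ : ℕ) → Family n → Set
ContainsMostChains {n} k ℓ F =
  Admissible k F × (∀ (F′ : Family n) → Admissible k F′ → #chains ℓ F′ ≤ #chains ℓ F)

-- _/ℕ_ rounds towards -∞, so these are the true floor and ceiling of z / 2 also when z < 0.
⌊_/2⌋ : ℤ → ℤ
⌊ z /2⌋ = z ℤ./ℕ 2

⌈_/2⌉ : ℤ → ℤ
⌈ z /2⌉ = ℤ.- ⌊ ℤ.- z /2⌋

layers : ∀ {n} (a b : ℤ) → Family n
layers a b G = does ((a ℤ.≤? + ∣ G ∣) ×-dec (+ ∣ G ∣ ℤ.≤? b))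

lowerMiddle : (n k : ℕ) → Family n
lowerMiddle n k = layers ⌊ + n ℤ.- + k /2⌋ ⌊ + n ℤ.+ + k /2⌋

upperMiddle : (n k : ℕ) → Family n
upperMiddle n k = layers ⌈ + n ℤ.- + k /2⌉ ⌈ + n ℤ.+ + k /2⌉

{-# OPTIONS --safe #-}
module Submission where

-- Every full chain ∅ = G₀ ⊂ … ⊂ Gₙ = [n] meets an admissible family inside a window of k + 1 consecutive
-- levels. Weight each ℓ-chain with sizes a₁ < … < a_ℓ by the multinomial coefficient
-- n! / (a₁! (a₂ - a₁)! … (n - a_ℓ)!), which is n! divided by the number of full chains through it. Then
-- n! times the number of ℓ-chains of F is the sum over all full chains of the weight of their ℓ-chains
-- in F, so it is at most n! times the largest total weight M t of a window t, …, t + k.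
-- Grouping by the gaps between consecutive sizes, with sum d,
--   M t = Σ_gaps multinomial(gaps) · C(n, d) · Σ_{x ≤ k - d} C(n - d, t + x),
-- and passing from t to t + 1 changes the inner sum by C(n - d, t + k + 1 - d) - C(n - d, t), which is ≥ 0
-- if 2t + k + 1 ≤ n and ≤ 0 if 2t + k + 1 ≥ n, strictly for d = ℓ - 1 next to the middle windows.
-- In the case of equality every full chain meets F in a whole middle window, and when there are two
-- middle windows the choice is the same for all full chains by a connectivity argument.

open import Defs
open import Data.Bool using (Bool; true; false; T; not; if_then_else_)
open import Data.Bool.Properties using (T?; T-≡; if-float)
open import Data.Fin.Subset using (Subset; inside; outside; _⊆_; _⊂_; _─_; ∣_∣; ⊥)
open import Data.Fin.Subset.Properties
open import Data.Integer as ℤ using (+<+; +≤+) renaming (+_ to pos)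
open import Data.Integer.DivMod using ([n/ℕd]*d≤n; n<s[n/ℕd]*d)
import Data.Integer.Properties as ℤ
import Data.Integer.Tactic.RingSolver as ℤ
open import Data.List using (List; []; _∷_; [_]; _++_; map; length; filter; cartesianProductWith; upTo; applyUpTo)
open import Data.List.Membership.Propositional using (_∈_)
open import Data.List.Membership.Propositional.Properties using (∈-upTo⁺; ∈-upTo⁻; ∈-cartesianProductWith⁺; ∈-cartesianProductWith⁻)
open import Data.List.Properties using (map-++; map-upTo; length-upTo)
open import Data.List.Relation.Unary.Any using (here; there)
open import Data.Nat as ℕ hiding (⌊_/2⌋; ⌈_/2⌉)
open import Data.Nat.Combinatorics using (nCk≡n!/k![n-k]!; k>n⇒nCk≡0; k![n∸k]!∣n!) renaming (_C_ to infixl 7.5 _C_)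
open import Data.Nat.Divisibility using (_∣_; divides; ∣m+n∣m⇒∣n; ∣1⇒≡1)
open import Data.Nat.DivMod using (m/n*n≡m)
import Data.Nat.ListAction as List
open import Data.Nat.ListAction.Properties using (sum-++)
open import Data.Nat.Properties
open import Data.Nat.Tactic.RingSolver using (solve-∀)
open import Data.Product using (_×_; _,_; ∃; proj₁; proj₂)
open import Data.Sum using (_⊎_; inj₁; inj₂)
open import Data.Vec as Vec using (Vec; []; _∷_; here; tail; sum; replicate)
open import Data.Vec.Relation.Unary.All as All using (All; []; _∷_; all?)
import Data.Vec.Relation.Unary.All.Properties as All
open import Data.Vec.Relation.Unary.Linked as Linked using (Linked; []; [-]; _∷_; linked?)
open import Function using (_∘_; id; _⇔_; mk⇔; Equivalence)
open import Relation.Binary.Construct.Closure.ReflexiveTransitive using (Star; ε; _◅_; _◅◅_; gmap)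
open import Relation.Binary.PropositionalEquality hiding ([_])
open import Relation.Nullary using (¬_; Dec; yes; no; does; contradiction)
open import Relation.Nullary.Decidable using (_×-dec_; dec-true; dec-false)
open import Algebra.Properties.CommutativeSemigroup +-commutativeSemigroup using (interchange)
open import Algebra.Properties.CommutativeSemigroup *-commutativeSemigroup using () renaming (interchange to *-interchange; x∙yz≈y∙xz to x*yz≡y*xz)
open import Relation.Unary using (Decidable)
open Equivalence using (to; from)

-- The turning point in `t` is the same for every gap vector. Shifting a window exchanges the
-- entries `t` and `t + k + 1 - d` of row `n - d`, and which of the two is larger depends on
-- comparing their index sum `2 t + k + 1 - d` with `n - d`; here `d` cancels. Hence all groups rise
-- and fall together, and their nonnegative combination does the same. Without the grouping, a shift
-- would exchange chains of many different weights at once.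
--
-- Full chains are coded by insertion levels rather than by permutations, so that every fact about
-- them is an induction on `n` that deletes the first element.
--
-- Uniqueness carries the hypothesis `ℓ ≤ n + 1`: for longer chains every count is 0, and every
-- admissible family is optimal.

private variable
  A B D P Q : Set

-- Finite sums

⟦_⟧ : Dec P → ℕ
⟦ d ⟧ = if does d then 1 else 0

⟦⟧≡1 : (d : Dec P) → P → ⟦ d ⟧ ≡ 1
⟦⟧≡1 (yes _) _ = refl
⟦⟧≡1 (no ¬p) p = contradiction p ¬p

⟦⟧≡0 : (d : Dec P) → ¬ P → ⟦ d ⟧ ≡ 0
⟦⟧≡0 (yes p) ¬p = contradiction p ¬p
⟦⟧≡0 (no _) _ = refl

⟦⟧-mono : (d : Dec P) (e : Dec Q) → (P → Q) → ⟦ d ⟧ ≤ ⟦ e ⟧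
⟦⟧-mono (no _) e _ = z≤n
⟦⟧-mono (yes p) e f = ≤-reflexive (sym (⟦⟧≡1 e (f p)))

⟦⟧-cong : (d : Dec P) (e : Dec Q) → (P → Q) → (Q → P) → ⟦ d ⟧ ≡ ⟦ e ⟧
⟦⟧-cong d e f g = ≤-antisym (⟦⟧-mono d e f) (⟦⟧-mono e d g)

∑ : List A → (A → ℕ) → ℕ
∑ xs f = List.sum (map f xs)

infix 5 ∑
syntax ∑ xs (λ x → e) = ∑[ x ∈ xs ] e

∑-cong : (xs : List A) {f g : A → ℕ} → (∀ {x} → x ∈ xs → f x ≡ g x) → ∑ xs f ≡ ∑ xs g
∑-cong [] _ = refl
∑-cong (x ∷ xs) eq = cong₂ _+_ (eq (here refl)) (∑-cong xs (eq ∘ there))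

∑-mono : (xs : List A) {f g : A → ℕ} → (∀ {x} → x ∈ xs → f x ≤ g x) → ∑ xs f ≤ ∑ xs g
∑-mono [] _ = z≤n
∑-mono (x ∷ xs) le = +-mono-≤ (le (here refl)) (∑-mono xs (le ∘ there))

∑-mono-< : (xs : List A) {f g : A → ℕ} → (∀ {x} → x ∈ xs → f x ≤ g x) →
  ∀ {y} → y ∈ xs → f y < g y → ∑ xs f < ∑ xs g
∑-mono-< (x ∷ xs) le (here refl) lt = +-mono-<-≤ lt (∑-mono xs (le ∘ there))
∑-mono-< (x ∷ xs) le (there y∈) lt = +-mono-≤-< (le (here refl)) (∑-mono-< xs (le ∘ there) y∈ lt)

-- This carries the case of equality twice: over all full chains, and over the level sequences of a
-- single full chain.
∑-tight : (xs : List A) {f g : A → ℕ} → (∀ {x} → x ∈ xs → f x ≤ g x) → ∑ xs g ≤ ∑ xs f →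
  ∀ {y} → y ∈ xs → f y ≡ g y
∑-tight xs {f} {g} le ge {y} y∈ with f y <? g y
... | yes lt = contradiction ge (<⇒≱ (∑-mono-< xs le y∈ lt))
... | no ≮ = ≤-antisym (le y∈) (≮⇒≥ ≮)

∑-+ : (xs : List A) (f g : A → ℕ) → ∑[ x ∈ xs ] (f x + g x) ≡ ∑ xs f + ∑ xs g
∑-+ [] f g = refl
∑-+ (x ∷ xs) f g = trans (cong (f x + g x +_) (∑-+ xs f g)) (interchange (f x) (g x) _ _)

∑-*ˡ : (xs : List A) (c : ℕ) (f : A → ℕ) → ∑[ x ∈ xs ] (c * f x) ≡ c * ∑ xs f
∑-*ˡ [] c f = sym (*-zeroʳ c)
∑-*ˡ (x ∷ xs) c f = trans (cong (c * f x +_) (∑-*ˡ xs c f)) (sym (*-distribˡ-+ c (f x) _))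

∑-*ʳ : (xs : List A) (c : ℕ) (f : A → ℕ) → ∑[ x ∈ xs ] (f x * c) ≡ ∑ xs f * c
∑-*ʳ xs c f = trans (∑-cong xs (λ {x} _ → *-comm (f x) c)) (trans (∑-*ˡ xs c f) (*-comm c _))

∑-zero : (xs : List A) {f : A → ℕ} → (∀ {x} → x ∈ xs → f x ≡ 0) → ∑ xs f ≡ 0
∑-zero xs eq = trans (∑-cong xs eq) (∑-*ˡ xs 0 (λ _ → 0))

∑-const : (xs : List A) (c : ℕ) → ∑ xs (λ _ → c) ≡ length xs * c
∑-const [] c = refl
∑-const (x ∷ xs) c = cong (c +_) (∑-const xs c)

∑-comm : (xs : List A) (ys : List B) (f : A → B → ℕ) →
  ∑[ x ∈ xs ] ∑[ y ∈ ys ] f x y ≡ ∑[ y ∈ ys ] ∑[ x ∈ xs ] f x y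
∑-comm [] ys f = sym (∑-zero ys (λ _ → refl))
∑-comm (x ∷ xs) ys f = trans (cong (∑ ys (f x) +_) (∑-comm xs ys f)) (sym (∑-+ ys (f x) _))

∑-++ : (xs ys : List A) (f : A → ℕ) → ∑ (xs ++ ys) f ≡ ∑ xs f + ∑ ys f
∑-++ xs ys f = trans (cong List.sum (map-++ f xs ys)) (sum-++ (map f xs) (map f ys))

∑-map : (h : A → B) (xs : List A) (f : B → ℕ) → ∑ (map h xs) f ≡ ∑ xs (f ∘ h)
∑-map h [] f = refl
∑-map h (x ∷ xs) f = cong (f (h x) +_) (∑-map h xs f)

∑-cartesianProductWith : (h : A → B → D) (xs : List A) (ys : List B) (f : D → ℕ) →
  ∑ (cartesianProductWith h xs ys) f ≡ ∑[ x ∈ xs ] ∑[ y ∈ ys ] f (h x y)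
∑-cartesianProductWith h [] ys f = refl
∑-cartesianProductWith h (x ∷ xs) ys f =
  trans (∑-++ (map (h x) ys) _ f) (cong₂ _+_ (∑-map (h x) ys f) (∑-cartesianProductWith h xs ys f))

∑-vectors-suc : (xs : List A) (m : ℕ) (f : Vec A (suc m) → ℕ) →
  ∑ (vectors xs (suc m)) f ≡ ∑[ x ∈ xs ] ∑[ S ∈ vectors xs m ] f (x ∷ S)
∑-vectors-suc xs m f = ∑-cartesianProductWith _∷_ xs (vectors xs m) f

length-filter≡∑ : {P : A → Set} (P? : Decidable P) (xs : List A) →
  length (filter P? xs) ≡ ∑[ x ∈ xs ] ⟦ P? x ⟧
length-filter≡∑ P? [] = refl
length-filter≡∑ P? (x ∷ xs) with does (P? x)
... | true = cong suc (length-filter≡∑ P? xs)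
... | false = length-filter≡∑ P? xs

∑-applyUpTo : (h : ℕ → A) (n : ℕ) (f : A → ℕ) → ∑ (applyUpTo h n) f ≡ ∑ (upTo n) (f ∘ h)
∑-applyUpTo h n f = trans (cong (λ xs → ∑ xs f) (sym (map-upTo h n))) (∑-map h (upTo n) f)

∑-upTo-suc : (n : ℕ) (f : ℕ → ℕ) → ∑ (upTo (suc n)) f ≡ f 0 + ∑ (upTo n) (f ∘ suc)
∑-upTo-suc n f = cong (f 0 +_) (∑-applyUpTo suc n f)

∑-upTo-+ : (m n : ℕ) (f : ℕ → ℕ) → ∑ (upTo (m + n)) f ≡ ∑ (upTo m) f + ∑ (upTo n) (f ∘ (m +_))
∑-upTo-+ zero n f = refl
∑-upTo-+ (suc m) n f = begin
  ∑ (upTo (suc m + n)) f                                      ≡⟨ ∑-upTo-suc (m + n) f ⟩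
  f 0 + ∑ (upTo (m + n)) (f ∘ suc)                            ≡⟨ cong (f 0 +_) (∑-upTo-+ m n (f ∘ suc)) ⟩
  f 0 + (∑ (upTo m) (f ∘ suc) + ∑ (upTo n) (f ∘ (suc m +_)))  ≡⟨ +-assoc (f 0) _ _ ⟨
  f 0 + ∑ (upTo m) (f ∘ suc) + ∑ (upTo n) (f ∘ (suc m +_))    ≡⟨ cong (_+ ∑ (upTo n) (f ∘ (suc m +_))) (∑-upTo-suc m f) ⟨
  ∑ (upTo (suc m)) f + ∑ (upTo n) (f ∘ (suc m +_))            ∎
  where open ≡-Reasoning

∑-upTo-last : (n : ℕ) (f : ℕ → ℕ) → ∑ (upTo (suc n)) f ≡ ∑ (upTo n) f + f n
∑-upTo-last n f = begin
  ∑ (upTo (suc n)) f             ≡⟨ cong (λ m → ∑ (upTo m) f) (+-comm 1 n) ⟩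
  ∑ (upTo (n + 1)) f             ≡⟨ ∑-upTo-+ n 1 f ⟩
  ∑ (upTo n) f + (f (n + 0) + 0) ≡⟨ cong (∑ (upTo n) f +_) (trans (+-identityʳ _) (cong f (+-identityʳ n))) ⟩
  ∑ (upTo n) f + f n             ∎
  where open ≡-Reasoning

∑-upTo-extend : (m n : ℕ) (f : ℕ → ℕ) → (∀ {x} → m ≤ x → f x ≡ 0) → ∑ (upTo (m + n)) f ≡ ∑ (upTo m) f
∑-upTo-extend m n f f≡0 =
  trans (∑-upTo-+ m n f) (trans (cong (∑ (upTo m) f +_) (∑-zero (upTo n) (λ {x} _ → f≡0 (m≤m+n m x)))) (+-identityʳ _))

∑-upTo-drop : (m n : ℕ) (f : ℕ → ℕ) → (∀ {x} → x < m → f x ≡ 0) → ∑ (upTo (m + n)) f ≡ ∑ (upTo n) (f ∘ (m +_))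
∑-upTo-drop m n f f≡0 =
  trans (∑-upTo-+ m n f) (cong (_+ ∑ (upTo n) (f ∘ (m +_))) (∑-zero (upTo m) (f≡0 ∘ ∈-upTo⁻)))

∑-interval : ∀ {a b n} → a ≤ suc b → b ≤ n → ∑[ p ∈ upTo (suc n) ] (⟦ a ≤? p ⟧ * ⟦ p ≤? b ⟧) ≡ suc b ∸ a
∑-interval {a} {b} {n} a≤1+b b≤n = begin
  ∑ (upTo (suc n)) f                       ≡⟨ cong (λ m → ∑ (upTo m) f) (m+[n∸m]≡n (s≤s b≤n)) ⟨
  ∑ (upTo (suc b + (suc n ∸ suc b))) f     ≡⟨ ∑-upTo-extend (suc b) _ f (λ {p} b<p →
                                                trans (cong (⟦ a ≤? p ⟧ *_) (⟦⟧≡0 (p ≤? b) (<⇒≱ b<p))) (*-zeroʳ ⟦ a ≤? p ⟧)) ⟩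
  ∑ (upTo (suc b)) f                       ≡⟨ cong (λ m → ∑ (upTo m) f) (m+[n∸m]≡n a≤1+b) ⟨
  ∑ (upTo (a + (suc b ∸ a))) f             ≡⟨ ∑-upTo-drop a _ f (λ {p} p<a → cong (_* ⟦ p ≤? b ⟧) (⟦⟧≡0 (a ≤? p) (<⇒≱ p<a))) ⟩
  ∑ (upTo (suc b ∸ a)) (f ∘ (a +_))        ≡⟨ ∑-cong (upTo (suc b ∸ a)) (λ {x} x∈ → cong₂ _*_
                                                (⟦⟧≡1 (a ≤? a + x) (m≤m+n a x))
                                                (⟦⟧≡1 (a + x ≤? b) (s≤s⁻¹ (≤-trans (+-monoʳ-< a (∈-upTo⁻ x∈)) (≤-reflexive (m+[n∸m]≡n a≤1+b)))))) ⟩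
  ∑ (upTo (suc b ∸ a)) (λ _ → 1)           ≡⟨ ∑-const (upTo (suc b ∸ a)) 1 ⟩
  length (upTo (suc b ∸ a)) * 1            ≡⟨ *-identityʳ _ ⟩
  length (upTo (suc b ∸ a))                ≡⟨ length-upTo (suc b ∸ a) ⟩
  suc b ∸ a                                ∎
  where
  open ≡-Reasoning
  f : ℕ → ℕ
  f p = ⟦ a ≤? p ⟧ * ⟦ p ≤? b ⟧

∈-vectors⁺ : ∀ {m} {S : Vec A m} {xs} → All (_∈ xs) S → S ∈ vectors xs m
∈-vectors⁺ [] = here refl
∈-vectors⁺ (x∈ ∷ S∈) = ∈-cartesianProductWith⁺ _∷_ x∈ (∈-vectors⁺ S∈)

∈-vectors⁻ : ∀ m {S : Vec A m} {xs} → S ∈ vectors xs m → All (_∈ xs) S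
∈-vectors⁻ zero {[]} _ = []
∈-vectors⁻ (suc m) {xs = xs} S∈ with ∈-cartesianProductWith⁻ _∷_ xs (vectors xs m) S∈
... | x , S , x∈ , S∈′ , refl = x∈ ∷ ∈-vectors⁻ m S∈′

-- Binomial coefficients

C-factorials : ∀ p q → (p + q) C p * (p ! * q !) ≡ (p + q) !
C-factorials p q = begin
  (p + q) C p * (p ! * q !)               ≡⟨ cong (λ r → (p + q) C p * (p ! * r !)) (m+n∸m≡n p q) ⟨
  (p + q) C p * (p ! * (p + q ∸ p) !)     ≡⟨ cong (_* (p ! * (p + q ∸ p) !)) (nCk≡n!/k![n-k]! (m≤m+n p q)) ⟩
  ((p + q) ! / d) * d                     ≡⟨ m/n*n≡m (k![n∸k]!∣n! (m≤m+n p q)) ⟩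
  (p + q) !                               ∎
  where
  open ≡-Reasoning
  d = p ! * (p + q ∸ p) !
  instance _ = p !* (p + q ∸ p) !≢0

-- Both sides count the disjoint pairs of an `x`-set and a `y`-set in `[n]`. The case `x + y > n`,
-- where both vanish, does occur in the later sums over gaps.
C-trinomial : ∀ n x y → n C x * (n ∸ x) C y ≡ n C (x + y) * (x + y) C x
C-trinomial n x y with x + y ≤? n
... | no x+y≰n = trans (lhs≡0 (x ≤? n)) (cong (_* (x + y) C x) (sym (k>n⇒nCk≡0 (≰⇒> x+y≰n))))
  where
  lhs≡0 : Dec (x ≤ n) → n C x * (n ∸ x) C y ≡ 0
  lhs≡0 (no x≰n) = cong (_* (n ∸ x) C y) (k>n⇒nCk≡0 (≰⇒> x≰n))
  lhs≡0 (yes x≤n) = trans (cong (n C x *_) (k>n⇒nCk≡0 {n ∸ x} {y} (+-cancelˡ-< x _ _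
    (subst (_< x + y) (sym (m+[n∸m]≡n x≤n)) (≰⇒> x+y≰n))))) (*-zeroʳ (n C x))
... | yes x+y≤n = subst (λ m → m C x * (m ∸ x) C y ≡ m C (x + y) * (x + y) C x) (m+[n∸m]≡n x+y≤n) (exact (n ∸ (x + y)))
  where
  open ≡-Reasoning
  exact : ∀ q → (x + y + q) C x * (x + y + q ∸ x) C y ≡ (x + y + q) C (x + y) * (x + y) C x
  exact q = *-cancelʳ-≡ _ _ (x ! * (y ! * q !)) {{m*n≢0 (x !) (y ! * q !) {{x !≢0}} {{y !* q !≢0}}}} (begin
    (x + y + q) C x * (x + y + q ∸ x) C y * (x ! * (y ! * q !))
      ≡⟨ cong (λ m → m C x * (m ∸ x) C y * (x ! * (y ! * q !))) (+-assoc x y q) ⟩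
    (x + (y + q)) C x * (x + (y + q) ∸ x) C y * (x ! * (y ! * q !))
      ≡⟨ cong (λ m → (x + (y + q)) C x * m C y * (x ! * (y ! * q !))) (m+n∸m≡n x (y + q)) ⟩
    (x + (y + q)) C x * (y + q) C y * (x ! * (y ! * q !))
      ≡⟨ rearrange₁ ((x + (y + q)) C x) ((y + q) C y) (x !) (y ! * q !) ⟩
    (x + (y + q)) C x * (x ! * ((y + q) C y * (y ! * q !)))
      ≡⟨ cong (λ m → (x + (y + q)) C x * (x ! * m)) (C-factorials y q) ⟩
    (x + (y + q)) C x * (x ! * (y + q) !)
      ≡⟨ C-factorials x (y + q) ⟩
    (x + (y + q)) !
      ≡⟨ cong _! (+-assoc x y q) ⟨
    (x + y + q) !
      ≡⟨ C-factorials (x + y) q ⟨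
    (x + y + q) C (x + y) * ((x + y) ! * q !)
      ≡⟨ cong (λ m → (x + y + q) C (x + y) * (m * q !)) (C-factorials x y) ⟨
    (x + y + q) C (x + y) * ((x + y) C x * (x ! * y !) * q !)
      ≡⟨ rearrange₂ ((x + y + q) C (x + y)) ((x + y) C x) (x !) (y !) (q !) ⟩
    (x + y + q) C (x + y) * (x + y) C x * (x ! * (y ! * q !)) ∎)
    where
    rearrange₁ : ∀ a b c d → a * b * (c * d) ≡ a * (c * (b * d))
    rearrange₁ = solve-∀
    rearrange₂ : ∀ a b c d e → a * (b * (c * d) * e) ≡ a * b * (c * (d * e))
    rearrange₂ = solve-∀

C-sym : ∀ x y → (x + y) C x ≡ (y + x) C y
C-sym x y = *-cancelʳ-≡ _ _ (x ! * y !) {{x !* y !≢0}} (begin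
  (x + y) C x * (x ! * y !)   ≡⟨ C-factorials x y ⟩
  (x + y) !                   ≡⟨ cong _! (+-comm x y) ⟩
  (y + x) !                   ≡⟨ C-factorials y x ⟨
  (y + x) C y * (y ! * x !)   ≡⟨ cong ((y + x) C y *_) (*-comm (y !) (x !)) ⟩
  (y + x) C y * (x ! * y !)   ∎)
  where open ≡-Reasoning

-- With `x` the bottom size of a chain and `y` its total gap, this pulls the factor of the total gap
-- out of the sum over bottom sizes.
C-swap : ∀ n x y → n C x * (n ∸ x) C y ≡ n C y * (n ∸ y) C x
C-swap n x y = begin
  n C x * (n ∸ x) C y         ≡⟨ C-trinomial n x y ⟩
  n C (x + y) * (x + y) C x   ≡⟨ cong₂ _*_ (cong (n C_) (+-comm x y)) (C-sym x y) ⟩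
  n C (y + x) * (y + x) C y   ≡⟨ C-trinomial n y x ⟨
  n C y * (n ∸ y) C x         ∎
  where open ≡-Reasoning

C>0 : ∀ {n x} → x ≤ n → 0 < n C x
C>0 {n} {x} x≤n = subst (λ m → 0 < m C x) (m+[n∸m]≡n x≤n)
  (n≢0⇒n>0 λ C≡0 → contradiction (trans (sym (C-factorials x (n ∸ x))) (cong (_* (x ! * (n ∸ x) !)) C≡0))
    (≢-nonZero⁻¹ _ {{(x + (n ∸ x)) !≢0}}))

-- After division by `p ! * q !` the factors `p + i` face the factors `q + i`, for `1 ≤ i ≤ s`.
factorials-mono : ∀ {p q} s → p ≤ q → (p + s) ! * q ! ≤ p ! * (q + s) !
factorials-mono {p} {q} zero _ = ≤-reflexive (cong₂ (λ a b → a ! * b !) (+-identityʳ p) (sym (+-identityʳ q)))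
factorials-mono {p} {q} (suc s) p≤q = begin
  (p + suc s) ! * q !               ≡⟨ cong (λ m → m ! * q !) (+-suc p s) ⟩
  suc (p + s) * (p + s) ! * q !     ≡⟨ *-assoc (suc (p + s)) ((p + s) !) (q !) ⟩
  suc (p + s) * ((p + s) ! * q !)   ≤⟨ *-mono-≤ (s≤s (+-monoˡ-≤ s p≤q)) (factorials-mono s p≤q) ⟩
  suc (q + s) * (p ! * (q + s) !)   ≡⟨ x*yz≡y*xz (suc (q + s)) (p !) _ ⟩
  p ! * (suc (q + s) * (q + s) !)   ≡⟨ cong (λ m → p ! * m !) (+-suc q s) ⟨
  p ! * (q + suc s) !               ∎
  where open ≤-Reasoning

factorials-mono-< : ∀ {p q s} → p < q → 0 < s → (p + s) ! * q ! < p ! * (q + s) !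
factorials-mono-< {p} {q} {suc s} p<q _ = begin-strict
  (p + suc s) ! * q !               ≡⟨ cong (λ m → m ! * q !) (+-suc p s) ⟩
  suc (p + s) * (p + s) ! * q !     ≡⟨ *-assoc (suc (p + s)) ((p + s) !) (q !) ⟩
  suc (p + s) * ((p + s) ! * q !)   <⟨ *-monoˡ-< _ {{(p + s) !* q !≢0}} (s≤s (+-monoˡ-< s p<q)) ⟩
  suc (q + s) * ((p + s) ! * q !)   ≤⟨ *-monoʳ-≤ (suc (q + s)) (factorials-mono s (<⇒≤ p<q)) ⟩
  suc (q + s) * (p ! * (q + s) !)   ≡⟨ x*yz≡y*xz (suc (q + s)) (p !) _ ⟩
  p ! * (suc (q + s) * (q + s) !)   ≡⟨ cong (λ m → p ! * m !) (+-suc q s) ⟨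
  p ! * (q + suc s) !               ∎
  where open ≤-Reasoning

private
  cofactor-≤ : ∀ {a b A B} → .{{NonZero A}} → a * A ≡ b * B → B ≤ A → a ≤ b
  cofactor-≤ {a} {b} {A} eq B≤A = *-cancelʳ-≤ a b A (≤-trans (≤-reflexive eq) (*-monoʳ-≤ b B≤A))

  cofactor-< : ∀ {a b A B} → 0 < b → a * A ≡ b * B → B < A → a < b
  cofactor-< {a} {b} {A} 0<b eq B<A = *-cancelʳ-< A a b (≤-<-trans (≤-reflexive eq) (*-monoʳ-< b {{>-nonZero 0<b}} B<A))

  -- Both sides are `(x + s + q) !`. Two entries of one row are thus cofactors of the same number,
  -- and they compare in the opposite order to their products of factorials.
  C-cofactors : ∀ x s q → (x + s + q) C x * (x ! * (q + s) !) ≡ (x + s + q) C (x + s) * ((x + s) ! * q !)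
  C-cofactors x s q = begin
    (x + s + q) C x * (x ! * (q + s) !)           ≡⟨ cong₂ (λ N r → N C x * (x ! * r !)) (+-assoc x s q) (+-comm q s) ⟩
    (x + (s + q)) C x * (x ! * (s + q) !)         ≡⟨ C-factorials x (s + q) ⟩
    (x + (s + q)) !                               ≡⟨ cong _! (+-assoc x s q) ⟨
    (x + s + q) !                                 ≡⟨ C-factorials (x + s) q ⟨
    (x + s + q) C (x + s) * ((x + s) ! * q !)     ∎
    where open ≡-Reasoning

  decompose : ∀ {N x y} → x ≤ y → y ≤ N → (P : ℕ → ℕ → Set) → P (x + (y ∸ x) + (N ∸ y)) (x + (y ∸ x)) → P N y
  decompose {N} {x} {y} x≤y y≤N P p =
    subst₂ P (trans (cong (_+ (N ∸ y)) (m+[n∸m]≡n x≤y)) (m+[n∸m]≡n y≤N)) (m+[n∸m]≡n x≤y) p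

-- The hypotheses say that `y` is at least as close to `N / 2` as `x`; in `C-anti` below, `x` is the
-- closer one.
C-mono : ∀ {N x y} → x ≤ y → x + y ≤ N → N C x ≤ N C y
C-mono {N} {x} {y} x≤y x+y≤N = decompose x≤y y≤N (λ N y → N C x ≤ N C y)
  (cofactor-≤ {{x !* (N ∸ y + (y ∸ x)) !≢0}} (C-cofactors x (y ∸ x) (N ∸ y)) (factorials-mono (y ∸ x) (m+n≤o⇒m≤o∸n x x+y≤N)))
  where y≤N = m+n≤o⇒n≤o x x+y≤N

C-mono-< : ∀ {N x y} → x < y → x + y < N → N C x < N C y
C-mono-< {N} {x} {y} x<y x+y<N = decompose (<⇒≤ x<y) y≤N (λ N y → N C x < N C y)
  (cofactor-< (C>0 (m≤m+n (x + (y ∸ x)) _)) (C-cofactors x (y ∸ x) (N ∸ y)) (factorials-mono-< (m+n≤o⇒m≤o∸n (suc x) x+y<N) (m<n⇒0<n∸m x<y)))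
  where y≤N = m+n≤o⇒n≤o x (<⇒≤ x+y<N)

C-anti : ∀ {N x y} → x ≤ y → N ≤ x + y → N C y ≤ N C x
C-anti {N} {x} {y} x≤y N≤x+y with y ≤? N
... | no y≰N = ≤-trans (≤-reflexive (k>n⇒nCk≡0 (≰⇒> y≰N))) z≤n
... | yes y≤N = decompose x≤y y≤N (λ N y → N C y ≤ N C x)
  (cofactor-≤ {{(x + (y ∸ x)) !* (N ∸ y) !≢0}} (sym (C-cofactors x (y ∸ x) (N ∸ y)))
    (subst₂ _≤_ (*-comm ((N ∸ y + (y ∸ x)) !) (x !)) (*-comm ((N ∸ y) !) _)
      (factorials-mono (y ∸ x) (m≤n+o⇒m∸n≤o N y (subst (N ≤_) (+-comm x y) N≤x+y)))))

-- `x ≤ N` excludes that both coefficients are 0.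
C-anti-< : ∀ {N x y} → x ≤ N → x < y → N < x + y → N C y < N C x
C-anti-< {N} {x} {y} x≤N x<y N<x+y with y ≤? N
... | no y≰N = ≤-<-trans (≤-reflexive (k>n⇒nCk≡0 (≰⇒> y≰N))) (C>0 x≤N)
... | yes y≤N = decompose (<⇒≤ x<y) y≤N (λ N y → N C y < N C x)
  (cofactor-< (C>0 (≤-trans (m≤m+n x (y ∸ x)) (m≤m+n _ (N ∸ y)))) (sym (C-cofactors x (y ∸ x) (N ∸ y)))
    (subst₂ _<_ (*-comm ((N ∸ y + (y ∸ x)) !) (x !)) (*-comm ((N ∸ y) !) _)
      (factorials-mono-< (+-cancelʳ-< y _ _ (subst (_< x + y) (sym (m∸n+n≡m y≤N)) N<x+y)) (m<n⇒0<n∸m x<y))))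

⟦⟧-absorb : ∀ {P Q : Set} (d : Dec P) (e : Dec Q) → (P → Q) → ⟦ d ⟧ * ⟦ e ⟧ ≡ ⟦ d ⟧
⟦⟧-absorb (no _) e _ = refl
⟦⟧-absorb (yes p) e f = cong (_+ 0) (⟦⟧≡1 e (f p))

-- Full chains

-- A full chain ∅ = G₀ ⊂ G₁ ⊂ … ⊂ Gₙ = [n] is coded by the level p after which the first
-- element is inserted, followed by the code of the chain that it induces on the remaining elements.
fullChains : (n : ℕ) → List (Vec ℕ n)
fullChains zero    = [ [] ]
fullChains (suc n) = cartesianProductWith _∷_ (upTo (suc n)) (fullChains n)

∈-fullChains⁻ : ∀ {n p} {c : Vec ℕ n} → p ∷ c ∈ fullChains (suc n) → p ≤ n × c ∈ fullChains n
∈-fullChains⁻ {n} pc∈ with ∈-cartesianProductWith⁻ _∷_ (upTo (suc n)) (fullChains n) pc∈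
... | p , c , p∈ , c∈ , refl = s≤s⁻¹ (∈-upTo⁻ p∈) , c∈

∈-fullChains⁺ : ∀ {n p} {c : Vec ℕ n} → p ≤ n → c ∈ fullChains n → p ∷ c ∈ fullChains (suc n)
∈-fullChains⁺ p≤n c∈ = ∈-cartesianProductWith⁺ _∷_ (∈-upTo⁺ (s≤s p≤n)) c∈

-- Beyond level `p` the first element is one of the `j` elements, which leaves `pred j` for the
-- induced chain.
level : ∀ {n} → Vec ℕ n → ℕ → Subset n
level [] j = []
level (p ∷ c) j = if does (j ≤? p) then outside ∷ level c j else inside ∷ level c (pred j)

level-≤ : ∀ {n p j} (c : Vec ℕ n) → j ≤ p → level (p ∷ c) j ≡ outside ∷ level c j
level-≤ {p = p} {j} c j≤p rewrite dec-true (j ≤? p) j≤p = refl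

level-> : ∀ {n p j} (c : Vec ℕ n) → p < j → level (p ∷ c) j ≡ inside ∷ level c (pred j)
level-> {p = p} {j} c p<j rewrite dec-false (j ≤? p) (<⇒≱ p<j) = refl

∣level∣ : ∀ {n j} {c : Vec ℕ n} → c ∈ fullChains n → j ≤ n → ∣ level c j ∣ ≡ j
∣level∣ {c = []} _ z≤n = refl
∣level∣ {j = j} {p ∷ c} pc∈ j≤n with ≤-<-connex j p | ∈-fullChains⁻ pc∈
... | inj₁ j≤p | p≤n , c∈ rewrite level-≤ c j≤p = ∣level∣ c∈ (≤-trans j≤p p≤n)
∣level∣ {j = suc j} {p ∷ c} pc∈ (s≤s j≤n) | inj₂ p<j | p≤n , c∈ rewrite level-> c p<j = cong suc (∣level∣ c∈ j≤n)

level-⊆ : ∀ {n i j} (c : Vec ℕ n) → i ≤ j → level c i ⊆ level c j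
level-⊆ [] i≤j = id
level-⊆ {i = i} {j} (p ∷ c) i≤j with ≤-<-connex i p | ≤-<-connex j p
... | inj₁ i≤p | inj₁ j≤p rewrite level-≤ c i≤p | level-≤ c j≤p = out⊆ (level-⊆ c i≤j)
... | inj₁ i≤p | inj₂ p<j rewrite level-≤ c i≤p | level-> c p<j = out⊆ (level-⊆ c (≤-trans i≤p (pred-mono-≤ p<j)))
... | inj₂ p<i | inj₁ j≤p = contradiction (≤-trans i≤j j≤p) (<⇒≱ p<i)
... | inj₂ p<i | inj₂ p<j rewrite level-> c p<i | level-> c p<j = in⊆in (level-⊆ c (pred-mono-≤ i≤j))

⊆∧∣∣<⇒⊂ : ∀ {n} (A B : Subset n) → A ⊆ B → ∣ A ∣ < ∣ B ∣ → A ⊂ B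
⊆∧∣∣<⇒⊂ [] [] A⊆B ()
⊆∧∣∣<⇒⊂ (outside ∷ A) (outside ∷ B) A⊆B lt = out⊂ (⊆∧∣∣<⇒⊂ A B (drop-∷-⊆ A⊆B) lt)
⊆∧∣∣<⇒⊂ (outside ∷ A) (inside ∷ B) A⊆B lt = out⊂in (drop-∷-⊆ A⊆B)
⊆∧∣∣<⇒⊂ (inside ∷ A) (outside ∷ B) A⊆B lt with () ← A⊆B here
⊆∧∣∣<⇒⊂ (inside ∷ A) (inside ∷ B) A⊆B lt = in⊂in (⊆∧∣∣<⇒⊂ A B (drop-∷-⊆ A⊆B) (s≤s⁻¹ lt))

∣─∣ : ∀ {n} (A B : Subset n) → A ⊆ B → ∣ B ─ A ∣ + ∣ A ∣ ≡ ∣ B ∣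
∣─∣ [] [] A⊆B = refl
∣─∣ (outside ∷ A) (outside ∷ B) A⊆B = ∣─∣ A B (drop-∷-⊆ A⊆B)
∣─∣ (outside ∷ A) (inside ∷ B) A⊆B = cong suc (∣─∣ A B (drop-∷-⊆ A⊆B))
∣─∣ (inside ∷ A) (outside ∷ B) A⊆B with () ← A⊆B here
∣─∣ (inside ∷ A) (inside ∷ B) A⊆B = trans (+-suc _ _) (cong suc (∣─∣ A B (drop-∷-⊆ A⊆B)))

level-⊂ : ∀ {n i j} {c : Vec ℕ n} → c ∈ fullChains n → i < j → j ≤ n → level c i ⊂ level c j
level-⊂ {c = c} c∈ i<j j≤n = ⊆∧∣∣<⇒⊂ _ _ (level-⊆ c (<⇒≤ i<j))
  (subst₂ _<_ (sym (∣level∣ c∈ (<⇒≤ (<-≤-trans i<j j≤n)))) (sym (∣level∣ c∈ j≤n)) i<j)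

-- passes c G is 1 if the full chain coded by c contains G, and 0 otherwise: when the level-p
-- member is the last one without the first element, G is a member iff its trace on the other
-- elements is a member of the induced chain and its size is on the right side of p.
fits : ℕ → Bool → ℕ → ℕ
fits p outside s = ⟦ s ≤? p ⟧
fits p inside  s = ⟦ p ≤? s ⟧

passes : ∀ {n} → Vec ℕ n → Subset n → ℕ
passes []      []      = 1
passes (p ∷ c) (b ∷ X) = fits p b ∣ X ∣ * passes c X

passesAll : ∀ {n ℓ} → Vec ℕ n → Vec (Subset n) ℓ → ℕ
passesAll c []       = 1
passesAll c (G ∷ Gs) = passes c G * passesAll c Gs

-- Level `p` of the induced chain occurs in both sums on the left: it gives the members just before
-- and just after the insertion, levels `p` and `p + 1`. So `n + 1` levels become `n + 2`.
∑-insert : ∀ {n p} → p ≤ n → (g h : ℕ → ℕ) →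
  (∑[ j ∈ upTo (suc n) ] ⟦ j ≤? p ⟧ * g j) + (∑[ j ∈ upTo (suc n) ] ⟦ p ≤? j ⟧ * h j)
    ≡ ∑[ j ∈ upTo (suc (suc n)) ] (if does (j ≤? p) then g j else h (pred j))
∑-insert {n} {p} p≤n g h = begin
  ∑ (upTo (suc n)) g′ + ∑ (upTo (suc n)) h′              ≡⟨ cong₂ _+_ below above ⟩
  ∑ (upTo (suc p)) g + ∑ (upTo (suc n ∸ p)) (h ∘ (p +_)) ≡⟨ cong₂ _+_
      (∑-cong (upTo (suc p)) (λ {j} j∈ → cong (λ b → if b then g j else h (pred j)) (sym (dec-true (j ≤? p) (s≤s⁻¹ (∈-upTo⁻ j∈))))))
      (∑-cong (upTo (suc n ∸ p)) (λ {j} _ → cong (λ b → if b then g (suc p + j) else h (p + j)) (sym (dec-false (suc p + j ≤? p) (<⇒≱ (m≤m+n (suc p) j)))))) ⟩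
  ∑ (upTo (suc p)) k + ∑ (upTo (suc n ∸ p)) (k ∘ (suc p +_)) ≡⟨ ∑-upTo-+ (suc p) (suc n ∸ p) k ⟨
  ∑ (upTo (suc p + (suc n ∸ p))) k                       ≡⟨ cong (λ m → ∑ (upTo (suc m)) k) (m+[n∸m]≡n (m≤n⇒m≤1+n p≤n)) ⟩
  ∑ (upTo (suc (suc n))) k                               ∎
  where
  open ≡-Reasoning
  g′ h′ k : ℕ → ℕ
  g′ j = ⟦ j ≤? p ⟧ * g j
  h′ j = ⟦ p ≤? j ⟧ * h j
  k j = if does (j ≤? p) then g j else h (pred j)
  below : ∑ (upTo (suc n)) g′ ≡ ∑ (upTo (suc p)) g
  below = begin
    ∑ (upTo (suc n)) g′              ≡⟨ cong (λ m → ∑ (upTo (suc m)) g′) (m+[n∸m]≡n p≤n) ⟨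
    ∑ (upTo (suc p + (n ∸ p))) g′    ≡⟨ ∑-upTo-extend (suc p) (n ∸ p) g′ (λ {j} p<j → cong (_* g j) (⟦⟧≡0 (j ≤? p) (<⇒≱ p<j))) ⟩
    ∑ (upTo (suc p)) g′              ≡⟨ ∑-cong (upTo (suc p)) (λ {j} j∈ → trans (cong (_* g j) (⟦⟧≡1 (j ≤? p) (s≤s⁻¹ (∈-upTo⁻ j∈)))) (*-identityˡ _)) ⟩
    ∑ (upTo (suc p)) g               ∎
  above : ∑ (upTo (suc n)) h′ ≡ ∑ (upTo (suc n ∸ p)) (h ∘ (p +_))
  above = begin
    ∑ (upTo (suc n)) h′              ≡⟨ cong (λ m → ∑ (upTo m) h′) (m+[n∸m]≡n (m≤n⇒m≤1+n p≤n)) ⟨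
    ∑ (upTo (p + (suc n ∸ p))) h′    ≡⟨ ∑-upTo-drop p (suc n ∸ p) h′ (λ {j} j<p → cong (_* h j) (⟦⟧≡0 (p ≤? j) (<⇒≱ j<p))) ⟩
    ∑ (upTo (suc n ∸ p)) (h′ ∘ (p +_)) ≡⟨ ∑-cong (upTo (suc n ∸ p)) (λ {j} _ → trans (cong (_* h (p + j)) (⟦⟧≡1 (p ≤? p + j) (m≤m+n p j))) (*-identityˡ _)) ⟩
    ∑ (upTo (suc n ∸ p)) (h ∘ (p +_)) ∎

-- A full chain consists of one set for each level. The test function `f` makes the induction work:
-- the size condition `fits` on the trace is absorbed into it before the recursive call.
∑-passes : ∀ {n} {c : Vec ℕ n} → c ∈ fullChains n → (f : Subset n → ℕ) →
  ∑[ X ∈ allSubsets n ] (passes c X * f X) ≡ ∑[ j ∈ upTo (suc n) ] f (level c j)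
∑-passes {zero} {[]} _ f = cong (_+ 0) (*-identityˡ (f []))
∑-passes {suc n} {p ∷ c} pc∈ f with ∈-fullChains⁻ pc∈
... | p≤n , c∈ = begin
  ∑[ X ∈ allSubsets (suc n) ] (passes (p ∷ c) X * f X)
    ≡⟨ ∑-cartesianProductWith _∷_ (outside ∷ inside ∷ []) (allSubsets n) _ ⟩
  ∑ (allSubsets n) (λ X → passes (p ∷ c) (outside ∷ X) * f (outside ∷ X)) + (∑ (allSubsets n) (λ X → passes (p ∷ c) (inside ∷ X) * f (inside ∷ X)) + 0)
    ≡⟨ cong₂ _+_ (half outside) (trans (+-identityʳ _) (half inside)) ⟩
  ∑ (upTo (suc n)) (λ j → ⟦ j ≤? p ⟧ * f (outside ∷ level c j)) + ∑ (upTo (suc n)) (λ j → ⟦ p ≤? j ⟧ * f (inside ∷ level c j))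
    ≡⟨ ∑-insert p≤n (λ j → f (outside ∷ level c j)) (λ j → f (inside ∷ level c j)) ⟩
  ∑ (upTo (suc (suc n))) (λ j → if does (j ≤? p) then f (outside ∷ level c j) else f (inside ∷ level c (pred j)))
    ≡⟨ ∑-cong (upTo (suc (suc n))) (λ {j} _ → sym (if-float f (does (j ≤? p)))) ⟩
  ∑ (upTo (suc (suc n))) (λ j → f (level (p ∷ c) j)) ∎
  where
  open ≡-Reasoning
  half : ∀ b → ∑ (allSubsets n) (λ X → passes (p ∷ c) (b ∷ X) * f (b ∷ X)) ≡ ∑ (upTo (suc n)) (λ j → fits p b j * f (b ∷ level c j))
  half b = begin
    ∑ (allSubsets n) (λ X → fits p b ∣ X ∣ * passes c X * f (b ∷ X))
      ≡⟨ ∑-cong (allSubsets n) (λ {X} _ → trans (*-assoc (fits p b ∣ X ∣) (passes c X) _) (x*yz≡y*xz (fits p b ∣ X ∣) (passes c X) _)) ⟩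
    ∑ (allSubsets n) (λ X → passes c X * (fits p b ∣ X ∣ * f (b ∷ X)))
      ≡⟨ ∑-passes c∈ (λ X → fits p b ∣ X ∣ * f (b ∷ X)) ⟩
    ∑ (upTo (suc n)) (λ j → fits p b ∣ level c j ∣ * f (b ∷ level c j))
      ≡⟨ ∑-cong (upTo (suc n)) (λ {j} j∈ → cong (λ s → fits p b s * f (b ∷ level c j)) (∣level∣ c∈ (s≤s⁻¹ (∈-upTo⁻ j∈)))) ⟩
    ∑ (upTo (suc n)) (λ j → fits p b j * f (b ∷ level c j)) ∎

∑-passesAll : ∀ {n} {c : Vec ℕ n} → c ∈ fullChains n → ∀ ℓ (f : Vec (Subset n) ℓ → ℕ) →
  ∑[ Gs ∈ vectors (allSubsets n) ℓ ] (passesAll c Gs * f Gs) ≡ ∑[ S ∈ vectors (upTo (suc n)) ℓ ] f (Vec.map (level c) S)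
∑-passesAll c∈ zero f = cong (_+ 0) (*-identityˡ (f []))
∑-passesAll {n} {c} c∈ (suc ℓ) f = begin
  ∑ (vectors (allSubsets n) (suc ℓ)) (λ Gs → passesAll c Gs * f Gs)
    ≡⟨ ∑-vectors-suc (allSubsets n) ℓ _ ⟩
  ∑ (allSubsets n) (λ G → ∑ (vectors (allSubsets n) ℓ) (λ Gs → passes c G * passesAll c Gs * f (G ∷ Gs)))
    ≡⟨ ∑-cong (allSubsets n) (λ {G} _ → trans
         (∑-cong (vectors (allSubsets n) ℓ) (λ {Gs} _ → *-assoc (passes c G) (passesAll c Gs) _))
         (∑-*ˡ (vectors (allSubsets n) ℓ) (passes c G) _)) ⟩
  ∑ (allSubsets n) (λ G → passes c G * ∑ (vectors (allSubsets n) ℓ) (λ Gs → passesAll c Gs * f (G ∷ Gs)))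
    ≡⟨ ∑-passes c∈ (λ G → ∑ (vectors (allSubsets n) ℓ) (λ Gs → passesAll c Gs * f (G ∷ Gs))) ⟩
  ∑ (upTo (suc n)) (λ j → ∑ (vectors (allSubsets n) ℓ) (λ Gs → passesAll c Gs * f (level c j ∷ Gs)))
    ≡⟨ ∑-cong (upTo (suc n)) (λ {j} _ → ∑-passesAll c∈ ℓ (λ Gs → f (level c j ∷ Gs))) ⟩
  ∑ (upTo (suc n)) (λ j → ∑ (vectors (upTo (suc n)) ℓ) (λ S → f (level c j ∷ Vec.map (level c) S)))
    ≡⟨ ∑-vectors-suc (upTo (suc n)) ℓ (λ S → f (Vec.map (level c) S)) ⟨
  ∑ (vectors (upTo (suc n)) (suc ℓ)) (λ S → f (Vec.map (level c) S)) ∎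
  where open ≡-Reasoning

-- The number of full chains through a given chain

sizes : ∀ {n ℓ} → Vec (Subset n) ℓ → Vec ℕ ℓ
sizes = Vec.map ∣_∣

-- The number of full chains of [n] through a given chain with sizes S is gapFactorials n 0 S.
-- Repeated sizes are allowed, since deleting an element may identify two members of the chain.
gapFactorials : ∀ {ℓ} → ℕ → ℕ → Vec ℕ ℓ → ℕ
gapFactorials n a []      = (n ∸ a) !
gapFactorials n a (b ∷ S) = (b ∸ a) ! * gapFactorials n b S

fitsAll : ∀ {n ℓ} → ℕ → Vec (Subset (suc n)) ℓ → ℕ
fitsAll p [] = 1
fitsAll p ((b ∷ X) ∷ Gs) = fits p b ∣ X ∣ * fitsAll p Gs

-- The insertion level `p` meets only sizes and first coordinates, the rest `c` only the traces. The
-- sum over `p` and `c` therefore becomes a product.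
passesAll-∷ : ∀ {n ℓ} p (c : Vec ℕ n) (Gs : Vec (Subset (suc n)) ℓ) →
  passesAll (p ∷ c) Gs ≡ fitsAll p Gs * passesAll c (Vec.map tail Gs)
passesAll-∷ p c [] = refl
passesAll-∷ p c ((b ∷ X) ∷ Gs) =
  trans (cong (fits p b ∣ X ∣ * passes c X *_) (passesAll-∷ p c Gs)) (*-interchange (fits p b ∣ X ∣) (passes c X) _ _)

-- Above a member with the first element all members have it, and their conditions on `p` follow
-- from the lowest one, because sizes increase.
fitsAll-inside : ∀ {n ℓ} p {X : Subset n} (Gs : Vec (Subset (suc n)) ℓ) → Linked _⊆_ ((inside ∷ X) ∷ Gs) →
  ⟦ p ≤? ∣ X ∣ ⟧ * fitsAll p Gs ≡ ⟦ p ≤? ∣ X ∣ ⟧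
fitsAll-inside p [] _ = *-identityʳ _
fitsAll-inside p ((outside ∷ Y) ∷ Gs) (X⊆Y ∷ _) with () ← X⊆Y here
fitsAll-inside p {X} ((inside ∷ Y) ∷ Gs) (X⊆Y ∷ lk) =
  trans (cong (⟦ p ≤? ∣ X ∣ ⟧ *_) (fitsAll-inside p Gs lk))
    (⟦⟧-absorb (p ≤? ∣ X ∣) (p ≤? ∣ Y ∣) λ p≤X → ≤-trans p≤X (p⊆q⇒∣p∣≤∣q∣ (drop-∷-⊆ X⊆Y)))

gapFactorials-inside : ∀ {n ℓ} {X : Subset n} (Gs : Vec (Subset (suc n)) ℓ) → Linked _⊆_ ((inside ∷ X) ∷ Gs) →
  gapFactorials (suc n) (suc ∣ X ∣) (sizes Gs) ≡ gapFactorials n (∣ X ∣) (sizes (Vec.map tail Gs))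
gapFactorials-inside [] _ = refl
gapFactorials-inside ((outside ∷ Y) ∷ Gs) (X⊆Y ∷ _) with () ← X⊆Y here
gapFactorials-inside {X = X} ((inside ∷ Y) ∷ Gs) (X⊆Y ∷ lk) = cong ((∣ Y ∣ ∸ ∣ X ∣) ! *_) (gapFactorials-inside Gs lk)

-- If `A` is the last trace without the first element and `X` the trace of the next member, then `p`
-- can be any of the `∣ X ∣ - ∣ A ∣ + 1` values from `∣ A ∣` to `∣ X ∣`. This factor turns
-- `(∣ X ∣ - ∣ A ∣) !` into the factorial of the gap enlarged by the first element; the other gaps
-- stay the same. If no member contains the first element, `n` takes the place of `∣ X ∣`.
∑-fitsAll : ∀ {n ℓ} (A : Subset n) (Gs : Vec (Subset (suc n)) ℓ) → Linked _⊆_ ((outside ∷ A) ∷ Gs) →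
  ∑ (upTo (suc n)) (λ p → ⟦ ∣ A ∣ ≤? p ⟧ * fitsAll p Gs) * gapFactorials n (∣ A ∣) (sizes (Vec.map tail Gs))
    ≡ gapFactorials (suc n) (∣ A ∣) (sizes Gs)
∑-fitsAll {n} A [] _ = begin
  ∑ (upTo (suc n)) (λ p → ⟦ ∣ A ∣ ≤? p ⟧ * 1) * (n ∸ ∣ A ∣) !
    ≡⟨ cong (_* (n ∸ ∣ A ∣) !) (∑-cong (upTo (suc n)) λ {p} p∈ → cong (⟦ ∣ A ∣ ≤? p ⟧ *_) (sym (⟦⟧≡1 (p ≤? n) (s≤s⁻¹ (∈-upTo⁻ p∈))))) ⟩
  ∑ (upTo (suc n)) (λ p → ⟦ ∣ A ∣ ≤? p ⟧ * ⟦ p ≤? n ⟧) * (n ∸ ∣ A ∣) !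
    ≡⟨ cong (_* (n ∸ ∣ A ∣) !) (trans (∑-interval (m≤n⇒m≤1+n (∣p∣≤n A)) ≤-refl) (+-∸-assoc 1 (∣p∣≤n A))) ⟩
  (suc (n ∸ ∣ A ∣)) !
    ≡⟨ cong _! (+-∸-assoc 1 (∣p∣≤n A)) ⟨
  (suc n ∸ ∣ A ∣) ! ∎
  where open ≡-Reasoning
∑-fitsAll {n} A ((outside ∷ X) ∷ Gs) (A⊆X ∷ lk) = begin
  ∑ (upTo (suc n)) (λ p → ⟦ ∣ A ∣ ≤? p ⟧ * (⟦ ∣ X ∣ ≤? p ⟧ * fitsAll p Gs)) * ((∣ X ∣ ∸ ∣ A ∣) ! * r)
    ≡⟨ cong (_* ((∣ X ∣ ∸ ∣ A ∣) ! * r)) (∑-cong (upTo (suc n)) λ {p} _ → begin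
         ⟦ ∣ A ∣ ≤? p ⟧ * (⟦ ∣ X ∣ ≤? p ⟧ * fitsAll p Gs)   ≡⟨ *-assoc ⟦ ∣ A ∣ ≤? p ⟧ _ _ ⟨
         ⟦ ∣ A ∣ ≤? p ⟧ * ⟦ ∣ X ∣ ≤? p ⟧ * fitsAll p Gs     ≡⟨ cong (_* fitsAll p Gs) (*-comm ⟦ ∣ A ∣ ≤? p ⟧ _) ⟩
         ⟦ ∣ X ∣ ≤? p ⟧ * ⟦ ∣ A ∣ ≤? p ⟧ * fitsAll p Gs     ≡⟨ cong (_* fitsAll p Gs) (⟦⟧-absorb (∣ X ∣ ≤? p) (∣ A ∣ ≤? p) (≤-trans (p⊆q⇒∣p∣≤∣q∣ A⊆X))) ⟩
         ⟦ ∣ X ∣ ≤? p ⟧ * fitsAll p Gs                      ∎) ⟩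
  ∑ (upTo (suc n)) (λ p → ⟦ ∣ X ∣ ≤? p ⟧ * fitsAll p Gs) * ((∣ X ∣ ∸ ∣ A ∣) ! * r)
    ≡⟨ x*yz≡y*xz (∑ (upTo (suc n)) (λ p → ⟦ ∣ X ∣ ≤? p ⟧ * fitsAll p Gs)) ((∣ X ∣ ∸ ∣ A ∣) !) r ⟩
  (∣ X ∣ ∸ ∣ A ∣) ! * (∑ (upTo (suc n)) (λ p → ⟦ ∣ X ∣ ≤? p ⟧ * fitsAll p Gs) * r)
    ≡⟨ cong ((∣ X ∣ ∸ ∣ A ∣) ! *_) (∑-fitsAll X Gs lk) ⟩
  (∣ X ∣ ∸ ∣ A ∣) ! * gapFactorials (suc n) (∣ X ∣) (sizes Gs) ∎
  where
  open ≡-Reasoning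
  r = gapFactorials n (∣ X ∣) (sizes (Vec.map tail Gs))
∑-fitsAll {n} A ((inside ∷ X) ∷ Gs) (A⊆X ∷ lk) = begin
  ∑ (upTo (suc n)) (λ p → ⟦ ∣ A ∣ ≤? p ⟧ * (⟦ p ≤? ∣ X ∣ ⟧ * fitsAll p Gs)) * ((∣ X ∣ ∸ ∣ A ∣) ! * r)
    ≡⟨ cong (_* ((∣ X ∣ ∸ ∣ A ∣) ! * r)) (∑-cong (upTo (suc n)) λ {p} _ → cong (⟦ ∣ A ∣ ≤? p ⟧ *_) (fitsAll-inside p Gs lk)) ⟩
  ∑ (upTo (suc n)) (λ p → ⟦ ∣ A ∣ ≤? p ⟧ * ⟦ p ≤? ∣ X ∣ ⟧) * ((∣ X ∣ ∸ ∣ A ∣) ! * r)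
    ≡⟨ cong (_* ((∣ X ∣ ∸ ∣ A ∣) ! * r)) (trans (∑-interval (m≤n⇒m≤1+n A≤X) (∣p∣≤n X)) (+-∸-assoc 1 A≤X)) ⟩
  suc (∣ X ∣ ∸ ∣ A ∣) * ((∣ X ∣ ∸ ∣ A ∣) ! * r)
    ≡⟨ *-assoc (suc (∣ X ∣ ∸ ∣ A ∣)) ((∣ X ∣ ∸ ∣ A ∣) !) r ⟨
  (suc (∣ X ∣ ∸ ∣ A ∣)) ! * r
    ≡⟨ cong₂ (λ m s → m ! * s) (+-∸-assoc 1 A≤X) (gapFactorials-inside Gs lk) ⟨
  (suc ∣ X ∣ ∸ ∣ A ∣) ! * gapFactorials (suc n) (suc ∣ X ∣) (sizes Gs) ∎
  where
  open ≡-Reasoning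
  r = gapFactorials n (∣ X ∣) (sizes (Vec.map tail Gs))
  A≤X = p⊆q⇒∣p∣≤∣q∣ (drop-∷-⊆ A⊆X)

Linked-tail : ∀ {n ℓ} {Gs : Vec (Subset (suc n)) ℓ} → Linked _⊆_ Gs → Linked _⊆_ (Vec.map tail Gs)
Linked-tail [] = []
Linked-tail [-] = [-]
Linked-tail {Gs = (_ ∷ X) ∷ (_ ∷ Y) ∷ Gs} (X⊆Y ∷ lk) = drop-∷-⊆ X⊆Y ∷ Linked-tail lk

∑-fullChains : ∀ {n ℓ} (Gs : Vec (Subset n) ℓ) → Linked _⊆_ Gs →
  ∑[ c ∈ fullChains n ] passesAll c Gs ≡ gapFactorials n 0 (sizes Gs)
∑-fullChains {zero} Gs _ = trans (+-identityʳ _) (trivial Gs)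
  where
  trivial : ∀ {ℓ} (Gs : Vec (Subset 0) ℓ) → passesAll [] Gs ≡ gapFactorials 0 0 (sizes Gs)
  trivial [] = refl
  trivial ([] ∷ Gs) = cong (_+ 0) (trivial Gs)
∑-fullChains {suc n} Gs lk = begin
  ∑ (fullChains (suc n)) (λ c → passesAll c Gs)
    ≡⟨ ∑-cartesianProductWith _∷_ (upTo (suc n)) (fullChains n) _ ⟩
  ∑ (upTo (suc n)) (λ p → ∑ (fullChains n) (λ c → passesAll (p ∷ c) Gs))
    ≡⟨ ∑-cong (upTo (suc n)) (λ {p} _ → trans
         (∑-cong (fullChains n) (λ {c} _ → passesAll-∷ p c Gs))
         (∑-*ˡ (fullChains n) (fitsAll p Gs) _)) ⟩
  ∑ (upTo (suc n)) (λ p → fitsAll p Gs * ∑ (fullChains n) (λ c → passesAll c (Vec.map tail Gs)))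
    ≡⟨ ∑-*ʳ (upTo (suc n)) (∑ (fullChains n) (λ c → passesAll c (Vec.map tail Gs))) (λ p → fitsAll p Gs) ⟩
  ∑ (upTo (suc n)) (λ p → fitsAll p Gs) * ∑ (fullChains n) (λ c → passesAll c (Vec.map tail Gs))
    ≡⟨ cong₂ _*_ (∑-cong (upTo (suc n)) {λ p → fitsAll p Gs} λ {p} _ → sym (+-identityʳ (fitsAll p Gs))) (∑-fullChains (Vec.map tail Gs) (Linked-tail lk)) ⟩
  ∑ (upTo (suc n)) (λ p → ⟦ 0 ≤? p ⟧ * fitsAll p Gs) * gapFactorials n 0 (sizes (Vec.map tail Gs))
    -- The empty set, put in front, serves as the preceding member without the first element.
    ≡⟨ subst (λ s → ∑ (upTo (suc n)) (λ p → ⟦ s ≤? p ⟧ * fitsAll p Gs) * gapFactorials n s (sizes (Vec.map tail Gs)) ≡ gapFactorials (suc n) s (sizes Gs))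
         (∣⊥∣≡0 n) (∑-fitsAll ⊥ Gs (from-⊥ lk)) ⟩
  gapFactorials (suc n) 0 (sizes Gs) ∎
  where
  open ≡-Reasoning
  from-⊥ : ∀ {ℓ} {Gs : Vec (Subset (suc n)) ℓ} → Linked _⊆_ Gs → Linked _⊆_ ((outside ∷ ⊥) ∷ Gs)
  from-⊥ [] = [-]
  from-⊥ {Gs = G ∷ []} [-] = ⊆-min G ∷ [-]
  from-⊥ {Gs = G ∷ _} lk@(_ ∷ _) = ⊆-min G ∷ lk

-- The first element is inserted after level `n` if it is in neither set, after the size of the
-- trace of `X` if it is only in `Y`, and after level 0 if it is in both.
through : ∀ {n} (X Y : Subset n) → X ⊆ Y → ∃ λ c → c ∈ fullChains n × level c ∣ X ∣ ≡ X × level c ∣ Y ∣ ≡ Y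
through [] [] _ = [] , here refl , refl , refl
through (b ∷ X) (b′ ∷ Y) X⊆Y with through X Y (drop-∷-⊆ X⊆Y) | p⊆q⇒∣p∣≤∣q∣ (drop-∷-⊆ X⊆Y)
through {suc n} (outside ∷ X) (outside ∷ Y) X⊆Y | c , c∈ , cX , cY | _ =
  n ∷ c , ∈-fullChains⁺ ≤-refl c∈ , trans (level-≤ c (∣p∣≤n X)) (cong (_ ∷_) cX) , trans (level-≤ c (∣p∣≤n Y)) (cong (_ ∷_) cY)
through (outside ∷ X) (inside ∷ Y) X⊆Y | c , c∈ , cX , cY | X≤Y =
  ∣ X ∣ ∷ c , ∈-fullChains⁺ (∣p∣≤n X) c∈ , trans (level-≤ c ≤-refl) (cong (_ ∷_) cX) , trans (level-> c (s≤s X≤Y)) (cong (_ ∷_) cY)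
through (inside ∷ X) (outside ∷ Y) X⊆Y | _ | _ with () ← X⊆Y here
through (inside ∷ X) (inside ∷ Y) X⊆Y | c , c∈ , cX , cY | _ =
  0 ∷ c , ∈-fullChains⁺ z≤n c∈ , trans (level-> c z<s) (cong (_ ∷_) cX) , trans (level-> c z<s) (cong (_ ∷_) cY)

-- Counting ℓ-chains through full chains

⟦⟧-× : ∀ {P Q R : Set} (d : Dec P) (e : Dec Q) (r : Dec R) → (P → Q × R) → (Q → R → P) → ⟦ d ⟧ ≡ ⟦ e ⟧ * ⟦ r ⟧
⟦⟧-× d (no ¬q) r f g = ⟦⟧≡0 d (¬q ∘ proj₁ ∘ f)
⟦⟧-× d (yes q) r f g = trans (⟦⟧-cong d r (proj₂ ∘ f) (g q)) (sym (+-identityʳ _))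

-- The number of ℓ-chains of [n] whose sizes are the entries of S is weight n 0 S.
weight : ∀ {ℓ} → ℕ → ℕ → Vec ℕ ℓ → ℕ
weight n a []      = 1
weight n a (b ∷ S) = (n ∸ a) C (b ∸ a) * weight n b S

-- Double counting above a fixed `a`-set: each of the `(n ∸ a) !` maximal chains from it to `[n]`
-- runs through exactly one sequence of sets with sizes `S`.
weight*gapFactorials : ∀ {n a ℓ} {S : Vec ℕ ℓ} → Linked _≤_ (a ∷ S) → All (_≤ n) S →
  weight n a S * gapFactorials n a S ≡ (n ∸ a) !
weight*gapFactorials {S = []} _ _ = +-identityʳ _
weight*gapFactorials {n} {a} {S = b ∷ S} (a≤b ∷ lk) (b≤n ∷ S≤n) = begin
  (n ∸ a) C (b ∸ a) * weight n b S * ((b ∸ a) ! * gapFactorials n b S)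
    ≡⟨ rearrange ((n ∸ a) C (b ∸ a)) (weight n b S) ((b ∸ a) !) (gapFactorials n b S) ⟩
  (n ∸ a) C (b ∸ a) * ((b ∸ a) ! * (weight n b S * gapFactorials n b S))
    ≡⟨ cong (λ r → (n ∸ a) C (b ∸ a) * ((b ∸ a) ! * r)) (weight*gapFactorials lk S≤n) ⟩
  (n ∸ a) C (b ∸ a) * ((b ∸ a) ! * (n ∸ b) !)
    ≡⟨ subst (λ N → N C (b ∸ a) * ((b ∸ a) ! * (n ∸ b) !) ≡ N !) split (C-factorials (b ∸ a) (n ∸ b)) ⟩
  (n ∸ a) ! ∎
  where
  open ≡-Reasoning
  rearrange : ∀ x y z w → x * y * (z * w) ≡ x * (z * (y * w))
  rearrange = solve-∀
  split : b ∸ a + (n ∸ b) ≡ n ∸ a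
  split = trans (sym (+-∸-comm (n ∸ b) a≤b)) (cong (_∸ a) (m+[n∸m]≡n b≤n))

weight>0 : ∀ {n ℓ} {S : Vec ℕ ℓ} → Linked _≤_ (0 ∷ S) → All (_≤ n) S → 0 < weight n 0 S
weight>0 {n} {S = S} lk S≤n = n≢0⇒n>0 λ w≡0 →
  contradiction (trans (sym (weight*gapFactorials lk S≤n)) (cong (_* gapFactorials n 0 S) w≡0)) (≢-nonZero⁻¹ (n !) {{n !≢0}})

Linked-0∷ : ∀ {ℓ} {S : Vec ℕ ℓ} → Linked _<_ S → Linked _≤_ (0 ∷ S)
Linked-0∷ [] = [-]
Linked-0∷ [-] = z≤n ∷ [-]
Linked-0∷ (lt ∷ lk) = z≤n ∷ Linked.map <⇒≤ (lt ∷ lk)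

∈-levels⁻ : ∀ {n} ℓ {S : Vec ℕ ℓ} → S ∈ vectors (upTo (suc n)) ℓ → All (_≤ n) S
∈-levels⁻ ℓ S∈ = All.map (s≤s⁻¹ ∘ ∈-upTo⁻) (∈-vectors⁻ ℓ S∈)

LevelChain : ∀ {ℓ} → (ℕ → Bool) → Vec ℕ ℓ → Set
LevelChain f S = Linked _<_ S × All (T ∘ f) S

levelChain? : ∀ {ℓ} f (S : Vec ℕ ℓ) → Dec (LevelChain f S)
levelChain? f S = linked? _<?_ S ×-dec all? (T? ∘ f) S

-- The contribution of one full chain to n ! * #chains ℓ F, where f selects the levels at which
-- the full chain meets F.
chainWeight : ℕ → ℕ → (ℕ → Bool) → ℕ
chainWeight n ℓ f = ∑[ S ∈ vectors (upTo (suc n)) ℓ ] (⟦ levelChain? f S ⟧ * weight n 0 S)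

module _ {n : ℕ} {c : Vec ℕ n} (c∈ : c ∈ fullChains n) where

  sizes-level : ∀ {ℓ} {S : Vec ℕ ℓ} → All (_≤ n) S → sizes (Vec.map (level c) S) ≡ S
  sizes-level [] = refl
  sizes-level (j≤n ∷ S≤n) = cong₂ _∷_ (∣level∣ c∈ j≤n) (sizes-level S≤n)

  isChain⁻ : ∀ {ℓ} {S : Vec ℕ ℓ} → All (_≤ n) S → IsChain (Vec.map (level c) S) → Linked _<_ S
  isChain⁻ [] [] = []
  isChain⁻ (_ ∷ []) [-] = [-]
  isChain⁻ (i≤n ∷ j≤n ∷ S≤n) (i⊂j ∷ lk) =
    subst₂ _<_ (∣level∣ c∈ i≤n) (∣level∣ c∈ j≤n) (p⊂q⇒∣p∣<∣q∣ i⊂j) ∷ isChain⁻ (j≤n ∷ S≤n) lk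

  isChain⁺ : ∀ {ℓ} {S : Vec ℕ ℓ} → All (_≤ n) S → Linked _<_ S → IsChain (Vec.map (level c) S)
  isChain⁺ [] [] = []
  isChain⁺ (_ ∷ []) [-] = [-]
  isChain⁺ (i≤n ∷ j≤n ∷ S≤n) (i<j ∷ lk) = level-⊂ c∈ i<j j≤n ∷ isChain⁺ (j≤n ∷ S≤n) lk

-- For each chain in `F` the factor `n !` is its weight times the number of full chains through it.
-- Exchanging the two sums then collects the contributions of each full chain.
#chains-fullChains : ∀ {n} ℓ (F : Family n) →
  n ! * #chains ℓ F ≡ ∑[ c ∈ fullChains n ] chainWeight n ℓ (F ∘ level c)
#chains-fullChains {n} ℓ F = begin
  n ! * #chains ℓ F
    ≡⟨ cong (n ! *_) (length-filter≡∑ (containsChain? F) (vectors (allSubsets n) ℓ)) ⟩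
  n ! * ∑ (vectors (allSubsets n) ℓ) (λ Gs → ⟦ containsChain? F Gs ⟧)
    ≡⟨ ∑-*ˡ (vectors (allSubsets n) ℓ) (n !) _ ⟨
  ∑ (vectors (allSubsets n) ℓ) (λ Gs → n ! * ⟦ containsChain? F Gs ⟧)
    ≡⟨ ∑-cong (vectors (allSubsets n) ℓ) (λ {Gs} _ → expand Gs (containsChain? F Gs)) ⟩
  ∑ (vectors (allSubsets n) ℓ) (λ Gs → ∑ (fullChains n) (λ c → passesAll c Gs * (⟦ containsChain? F Gs ⟧ * weight n 0 (sizes Gs))))
    ≡⟨ ∑-comm (vectors (allSubsets n) ℓ) (fullChains n) _ ⟩
  ∑ (fullChains n) (λ c → ∑ (vectors (allSubsets n) ℓ) (λ Gs → passesAll c Gs * (⟦ containsChain? F Gs ⟧ * weight n 0 (sizes Gs))))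
    ≡⟨ ∑-cong (fullChains n) (λ c∈ → trans (∑-passesAll c∈ ℓ _)
         (∑-cong (vectors (upTo (suc n)) ℓ) (λ S∈ → on-level c∈ (∈-levels⁻ ℓ S∈)))) ⟩
  ∑ (fullChains n) (λ c → chainWeight n ℓ (F ∘ level c)) ∎
  where
  open ≡-Reasoning
  sizes-≤ : ∀ {ℓ} (Gs : Vec (Subset n) ℓ) → All (_≤ n) (sizes Gs)
  sizes-≤ [] = []
  sizes-≤ (G ∷ Gs) = ∣p∣≤n G ∷ sizes-≤ Gs
  sizes-≤-linked : ∀ {ℓ} {Gs : Vec (Subset n) ℓ} → IsChain Gs → Linked _<_ (sizes Gs)
  sizes-≤-linked [] = []
  sizes-≤-linked [-] = [-]
  sizes-≤-linked {Gs = _ ∷ _ ∷ _} (G⊂H ∷ lk) = p⊂q⇒∣p∣<∣q∣ G⊂H ∷ sizes-≤-linked lk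
  expand : ∀ Gs (d : Dec (F ContainsChain Gs)) →
    n ! * ⟦ d ⟧ ≡ ∑ (fullChains n) (λ c → passesAll c Gs * (⟦ d ⟧ * weight n 0 (sizes Gs)))
  expand Gs (no _) = trans (*-zeroʳ (n !)) (sym (∑-zero (fullChains n) (λ {c} _ → *-zeroʳ (passesAll c Gs))))
  expand Gs (yes (chain , _)) = begin
    n ! * 1                                                          ≡⟨ *-identityʳ (n !) ⟩
    n !                                                              ≡⟨ weight*gapFactorials (Linked-0∷ (sizes-≤-linked chain)) (sizes-≤ Gs) ⟨
    w * gapFactorials n 0 (sizes Gs)                                 ≡⟨ *-comm w _ ⟩
    gapFactorials n 0 (sizes Gs) * w                                 ≡⟨ cong₂ _*_ (sym (∑-fullChains Gs (Linked.map {R = _⊂_} {S = _⊆_} (λ A⊂B {x} → proj₁ A⊂B {x}) chain))) (sym (+-identityʳ w)) ⟩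
    ∑ (fullChains n) (λ c → passesAll c Gs) * (1 * w)                ≡⟨ ∑-*ʳ (fullChains n) (1 * w) (λ c → passesAll c Gs) ⟨
    ∑ (fullChains n) (λ c → passesAll c Gs * (1 * w))                ∎
    where w = weight n 0 (sizes Gs)
  on-level : ∀ {c} → c ∈ fullChains n → ∀ {S : Vec ℕ ℓ} → All (_≤ n) S →
    ⟦ containsChain? F (Vec.map (level c) S) ⟧ * weight n 0 (sizes (Vec.map (level c) S)) ≡ ⟦ levelChain? (F ∘ level c) S ⟧ * weight n 0 S
  on-level {c} c∈ {S} S≤n = cong₂ _*_
    (⟦⟧-cong (containsChain? F (Vec.map (level c) S)) (levelChain? (F ∘ level c) S)
      (λ (chain , all) → isChain⁻ c∈ S≤n chain , All.map⁻ all)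
      (λ (lk , all) → isChain⁺ c∈ S≤n lk , All.map⁺ all))
    (cong (weight n 0) (sizes-level c∈ S≤n))

module _ {n ℓ : ℕ} {f g : ℕ → Bool} (f⇒g : ∀ {j} → j ≤ n → T (f j) → T (g j)) where

  levelChain-map : {S : Vec ℕ ℓ} → All (_≤ n) S → LevelChain f S → LevelChain g S
  levelChain-map S≤n (lk , all) = lk , All.map (λ (j≤n , fj) → f⇒g j≤n fj) (All.zip (S≤n , all))

  private
    term-mono : {S : Vec ℕ ℓ} → S ∈ vectors (upTo (suc n)) ℓ →
      ⟦ levelChain? f S ⟧ * weight n 0 S ≤ ⟦ levelChain? g S ⟧ * weight n 0 S
    term-mono {S} S∈ = *-monoˡ-≤ (weight n 0 S) (⟦⟧-mono (levelChain? f S) (levelChain? g S) (levelChain-map (∈-levels⁻ ℓ S∈)))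

  chainWeight-mono : chainWeight n ℓ f ≤ chainWeight n ℓ g
  chainWeight-mono = ∑-mono (vectors (upTo (suc n)) ℓ) term-mono

  -- All weights are positive, so equal totals leave no room for a level chain of `g` that `f`
  -- misses.
  chainWeight-tight : chainWeight n ℓ g ≤ chainWeight n ℓ f →
    {S : Vec ℕ ℓ} → All (_≤ n) S → LevelChain g S → LevelChain f S
  chainWeight-tight ge {S} S≤n gS@(lk , _) with levelChain? f S in eq
  ... | yes fS = fS
  ... | no ¬fS = contradiction (begin-equality
    0                                    ≡⟨ cong (_* weight n 0 S) (⟦⟧≡0 (levelChain? f S) ¬fS) ⟨
    ⟦ levelChain? f S ⟧ * weight n 0 S   ≡⟨ ∑-tight (vectors (upTo (suc n)) ℓ) term-mono ge (∈-vectors⁺ (All.map (∈-upTo⁺ ∘ s≤s) S≤n)) ⟩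
    ⟦ levelChain? g S ⟧ * weight n 0 S   ≡⟨ cong (_* weight n 0 S) (⟦⟧≡1 (levelChain? g S) gS) ⟩
    1 * weight n 0 S                     ≡⟨ *-identityˡ _ ⟩
    weight n 0 S                         ∎)
    (<⇒≢ (weight>0 (Linked-0∷ lk) S≤n))
    where open ≤-Reasoning

chainWeight-cong : ∀ {n ℓ f g} → (∀ {j} → j ≤ n → T (f j) → T (g j)) → (∀ {j} → j ≤ n → T (g j) → T (f j)) →
  chainWeight n ℓ f ≡ chainWeight n ℓ g
chainWeight-cong {ℓ = ℓ} f⇒g g⇒f = ≤-antisym (chainWeight-mono {ℓ = ℓ} f⇒g) (chainWeight-mono {ℓ = ℓ} g⇒f)

-- Chains in a window of levels

m∸n≤o⇒m≤n+o : ∀ m n {o} → m ∸ n ≤ o → m ≤ n + o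
m∸n≤o⇒m≤n+o m n le = ≤-trans (m≤n+m∸n m n) (+-monoʳ-≤ n le)

-- Substitution `b = a + x`. The range of the gap `x` is padded by zero terms up to `n`, so that all
-- gaps range over one list that does not depend on `a`.
∑-shift : ∀ {n a} → a ≤ n → (h : ℕ → ℕ) → (∀ {b} → n < b → h b ≡ 0) →
  ∑[ b ∈ upTo (suc n) ] (⟦ a <? b ⟧ * h b) ≡ ∑[ x ∈ upTo (suc n) ] (⟦ 0 <? x ⟧ * h (a + x))
∑-shift {n} {a} a≤n h h≡0 = begin
  ∑ (upTo (suc n)) φ                ≡⟨ cong (λ m → ∑ (upTo m) φ) (m+[n∸m]≡n (m≤n⇒m≤1+n a≤n)) ⟨
  ∑ (upTo (a + (suc n ∸ a))) φ      ≡⟨ ∑-upTo-drop a (suc n ∸ a) φ (λ {b} b<a → cong (_* h b) (⟦⟧≡0 (a <? b) (<⇒≱ b<a ∘ <⇒≤))) ⟩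
  ∑ (upTo (suc n ∸ a)) (φ ∘ (a +_)) ≡⟨ ∑-cong (upTo (suc n ∸ a)) (λ {x} _ → cong (_* h (a + x)) (⟦⟧-cong (a <? a + x) (0 <? x) (x>0 x) (m<m+n a))) ⟩
  ∑ (upTo (suc n ∸ a)) ψ            ≡⟨ ∑-upTo-extend (suc n ∸ a) a ψ (λ {x} le → trans (cong (⟦ 0 <? x ⟧ *_) (h≡0 (beyond le))) (*-zeroʳ ⟦ 0 <? x ⟧)) ⟨
  ∑ (upTo (suc n ∸ a + a)) ψ        ≡⟨ cong (λ m → ∑ (upTo m) ψ) (m∸n+n≡m (m≤n⇒m≤1+n a≤n)) ⟩
  ∑ (upTo (suc n)) ψ                ∎
  where
  open ≡-Reasoning
  φ ψ : ℕ → ℕ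
  φ b = ⟦ a <? b ⟧ * h b
  ψ x = ⟦ 0 <? x ⟧ * h (a + x)
  x>0 : ∀ x → a < a + x → 0 < x
  x>0 x lt = +-cancelˡ-< a 0 x (subst (_< a + x) (sym (+-identityʳ a)) lt)
  beyond : ∀ {x} → suc n ∸ a ≤ x → n < a + x
  beyond = m∸n≤o⇒m≤n+o (suc n) a

multinomial : ∀ {m} → Vec ℕ m → ℕ
multinomial []      = 1
multinomial (x ∷ g) = (x + sum g) C x * multinomial g

Positive : ∀ {m} → Vec ℕ m → Set
Positive = All (0 <_)

positive? : ∀ {m} (g : Vec ℕ m) → Dec (Positive g)
positive? = all? (0 <?_)

-- Replacing the entries of S by their gaps g makes the weight split as a multinomial depending on g
-- only, times a binomial coefficient; this is what allows windows to be compared gap vector by gap vector.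
∑-above : ∀ {n a} u m → a ≤ n →
  ∑[ S ∈ vectors (upTo (suc n)) m ] (⟦ linked? _<?_ (a ∷ S) ×-dec all? (_≤? u) (a ∷ S) ⟧ * weight n a S)
    ≡ ∑[ g ∈ vectors (upTo (suc n)) m ] (⟦ positive? g ⟧ * (⟦ a + sum g ≤? u ⟧ * ((n ∸ a) C sum g * multinomial g)))
∑-above {n} {a} u zero a≤n = cong (_+ 0) (begin
  ⟦ linked? _<?_ (a ∷ []) ×-dec all? (_≤? u) (a ∷ []) ⟧ * 1
    ≡⟨ *-identityʳ _ ⟩
  ⟦ linked? _<?_ (a ∷ []) ×-dec all? (_≤? u) (a ∷ []) ⟧
    ≡⟨ ⟦⟧-cong (linked? _<?_ (a ∷ []) ×-dec all? (_≤? u) (a ∷ [])) (a + 0 ≤? u)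
         (λ { (_ , a≤u ∷ []) → subst (_≤ u) (sym (+-identityʳ a)) a≤u }) (λ a≤u → [-] , subst (_≤ u) (+-identityʳ a) a≤u ∷ []) ⟩
  ⟦ a + 0 ≤? u ⟧
    ≡⟨ trans (+-identityʳ _) (*-identityʳ _) ⟨
  ⟦ a + 0 ≤? u ⟧ * 1 + 0 ∎)
  where open ≡-Reasoning
∑-above {n} {a} u (suc m) a≤n = begin
  ∑ (vectors (upTo (suc n)) (suc m)) (λ S → ⟦ chain? a S ⟧ * weight n a S)
    ≡⟨ ∑-vectors-suc (upTo (suc n)) m (λ S → ⟦ chain? a S ⟧ * weight n a S) ⟩
  ∑ (upTo (suc n)) (λ b → ∑ (vectors (upTo (suc n)) m) (λ S → ⟦ chain? a (b ∷ S) ⟧ * ((n ∸ a) C (b ∸ a) * weight n b S)))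
    ≡⟨ ∑-cong (upTo (suc n)) (λ {b} b∈ → begin
         ∑ (vectors (upTo (suc n)) m) (λ S → ⟦ chain? a (b ∷ S) ⟧ * ((n ∸ a) C (b ∸ a) * weight n b S))
           ≡⟨ ∑-cong (vectors (upTo (suc n)) m) (λ {S} _ → trans
                (cong (_* ((n ∸ a) C (b ∸ a) * weight n b S)) (⟦⟧-× (chain? a (b ∷ S)) (a <? b) (chain? b S) uncons cons))
                (rearrange₁ ⟦ a <? b ⟧ ⟦ chain? b S ⟧ ((n ∸ a) C (b ∸ a)) (weight n b S))) ⟩
         ∑ (vectors (upTo (suc n)) m) (λ S → ⟦ a <? b ⟧ * ((n ∸ a) C (b ∸ a)) * (⟦ chain? b S ⟧ * weight n b S))
           ≡⟨ ∑-*ˡ (vectors (upTo (suc n)) m) (⟦ a <? b ⟧ * ((n ∸ a) C (b ∸ a))) _ ⟩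
         ⟦ a <? b ⟧ * ((n ∸ a) C (b ∸ a)) * ∑ (vectors (upTo (suc n)) m) (λ S → ⟦ chain? b S ⟧ * weight n b S)
           ≡⟨ cong (⟦ a <? b ⟧ * ((n ∸ a) C (b ∸ a)) *_) (∑-above u m (s≤s⁻¹ (∈-upTo⁻ b∈))) ⟩
         ⟦ a <? b ⟧ * ((n ∸ a) C (b ∸ a)) * ∑ (vectors (upTo (suc n)) m) (rest b)
           ≡⟨ *-assoc ⟦ a <? b ⟧ ((n ∸ a) C (b ∸ a)) _ ⟩
         ⟦ a <? b ⟧ * h b ∎) ⟩
  ∑ (upTo (suc n)) (λ b → ⟦ a <? b ⟧ * h b)
    ≡⟨ ∑-shift a≤n h (λ {b} n<b → cong (_* ∑ (vectors (upTo (suc n)) m) (rest b)) (k>n⇒nCk≡0 (∸-monoˡ-< n<b a≤n))) ⟩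
  ∑ (upTo (suc n)) (λ x → ⟦ 0 <? x ⟧ * h (a + x))
    ≡⟨ ∑-cong (upTo (suc n)) (λ {x} _ → begin
         ⟦ 0 <? x ⟧ * ((n ∸ a) C (a + x ∸ a) * ∑ (vectors (upTo (suc n)) m) (rest (a + x)))
           ≡⟨ *-assoc ⟦ 0 <? x ⟧ ((n ∸ a) C (a + x ∸ a)) _ ⟨
         ⟦ 0 <? x ⟧ * (n ∸ a) C (a + x ∸ a) * ∑ (vectors (upTo (suc n)) m) (rest (a + x))
           ≡⟨ ∑-*ˡ (vectors (upTo (suc n)) m) (⟦ 0 <? x ⟧ * (n ∸ a) C (a + x ∸ a)) (rest (a + x)) ⟨
         ∑ (vectors (upTo (suc n)) m) (λ g → ⟦ 0 <? x ⟧ * (n ∸ a) C (a + x ∸ a) * rest (a + x) g)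
           ≡⟨ ∑-cong (vectors (upTo (suc n)) m) (λ {g} _ → merge x g) ⟩
         ∑ (vectors (upTo (suc n)) m) (λ g → ⟦ positive? (x ∷ g) ⟧ * (⟦ a + sum (x ∷ g) ≤? u ⟧ * ((n ∸ a) C sum (x ∷ g) * multinomial (x ∷ g)))) ∎) ⟩
  ∑ (upTo (suc n)) (λ x → ∑ (vectors (upTo (suc n)) m) (λ g → ⟦ positive? (x ∷ g) ⟧ * (⟦ a + sum (x ∷ g) ≤? u ⟧ * ((n ∸ a) C sum (x ∷ g) * multinomial (x ∷ g)))))
    ≡⟨ ∑-vectors-suc (upTo (suc n)) m
         (λ g → ⟦ positive? g ⟧ * (⟦ a + sum g ≤? u ⟧ * ((n ∸ a) C sum g * multinomial g))) ⟨
  ∑ (vectors (upTo (suc n)) (suc m)) (λ g → ⟦ positive? g ⟧ * (⟦ a + sum g ≤? u ⟧ * ((n ∸ a) C sum g * multinomial g))) ∎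
  where
  open ≡-Reasoning
  Chain : ∀ {m} → ℕ → Vec ℕ m → Set
  Chain a S = Linked _<_ (a ∷ S) × All (_≤ u) (a ∷ S)
  chain? : ∀ {m} a (S : Vec ℕ m) → Dec (Chain a S)
  chain? a S = linked? _<?_ (a ∷ S) ×-dec all? (_≤? u) (a ∷ S)
  uncons : ∀ {b m} {S : Vec ℕ m} → Chain a (b ∷ S) → a < b × Chain b S
  uncons (a<b ∷ lk , _ ∷ le) = a<b , lk , le
  cons : ∀ {b m} {S : Vec ℕ m} → a < b → Chain b S → Chain a (b ∷ S)
  cons a<b (lk , b≤u ∷ le) = a<b ∷ lk , ≤-trans (<⇒≤ a<b) b≤u ∷ b≤u ∷ le
  rest : ℕ → Vec ℕ m → ℕ
  rest b g = ⟦ positive? g ⟧ * (⟦ b + sum g ≤? u ⟧ * ((n ∸ b) C sum g * multinomial g))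
  h : ℕ → ℕ
  h b = (n ∸ a) C (b ∸ a) * ∑ (vectors (upTo (suc n)) m) (rest b)
  rearrange₁ : ∀ x y z w → x * y * (z * w) ≡ x * z * (y * w)
  rearrange₁ = solve-∀
  rearrange₂ : ∀ p c q i d μ → p * c * (q * (i * (d * μ))) ≡ p * q * (i * (c * d * μ))
  rearrange₂ = solve-∀
  merge : ∀ x g → ⟦ 0 <? x ⟧ * (n ∸ a) C (a + x ∸ a) * rest (a + x) g
    ≡ ⟦ positive? (x ∷ g) ⟧ * (⟦ a + sum (x ∷ g) ≤? u ⟧ * ((n ∸ a) C sum (x ∷ g) * multinomial (x ∷ g)))
  merge x g = begin
    ⟦ 0 <? x ⟧ * (n ∸ a) C (a + x ∸ a) * rest (a + x) g
      ≡⟨ cong₂ (λ y r → ⟦ 0 <? x ⟧ * (n ∸ a) C y * (⟦ positive? g ⟧ * (⟦ a + x + sum g ≤? u ⟧ * (r C sum g * multinomial g))))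
           (m+n∸m≡n a x) (sym (∸-+-assoc n a x)) ⟩
    ⟦ 0 <? x ⟧ * (n ∸ a) C x * (⟦ positive? g ⟧ * (⟦ a + x + sum g ≤? u ⟧ * ((n ∸ a ∸ x) C sum g * multinomial g)))
      ≡⟨ rearrange₂ ⟦ 0 <? x ⟧ ((n ∸ a) C x) ⟦ positive? g ⟧ ⟦ a + x + sum g ≤? u ⟧ ((n ∸ a ∸ x) C sum g) (multinomial g) ⟩
    ⟦ 0 <? x ⟧ * ⟦ positive? g ⟧ * (⟦ a + x + sum g ≤? u ⟧ * ((n ∸ a) C x * (n ∸ a ∸ x) C sum g * multinomial g))
      ≡⟨ cong₂ _*_
           (sym (⟦⟧-× (positive? (x ∷ g)) (0 <? x) (positive? g) (λ { (p ∷ ps) → p , ps }) _∷_))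
           (cong₂ _*_
             (cong (λ y → ⟦ y ≤? u ⟧) (+-assoc a x (sum g)))
             -- The trinomial identity splits off `(x + sum g) C x`, exactly the factor that
             -- `multinomial` gains from the new gap.
             (trans (cong (_* multinomial g) (C-trinomial (n ∸ a) x (sum g))) (*-assoc ((n ∸ a) C (x + sum g)) _ _))) ⟩
    ⟦ positive? (x ∷ g) ⟧ * (⟦ a + sum (x ∷ g) ≤? u ⟧ * ((n ∸ a) C sum (x ∷ g) * multinomial (x ∷ g))) ∎

T-does⁺ : ∀ {P : Set} (d : Dec P) → P → T (does d)
T-does⁺ (yes _) _ = _
T-does⁺ (no ¬p) p = ¬p p

T-does⁻ : ∀ {P : Set} (d : Dec P) → T (does d) → P
T-does⁻ (yes p) _ = p

window : ℕ → ℕ → ℕ → Bool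
window k t j = does (t ≤? j ×-dec j ≤? t + k)

window⁺ : ∀ {k t j} → t ≤ j → j ≤ t + k → T (window k t j)
window⁺ {k} {t} {j} t≤j j≤t+k = T-does⁺ (t ≤? j ×-dec j ≤? t + k) (t≤j , j≤t+k)

window⁻ : ∀ {k t j} → T (window k t j) → t ≤ j × j ≤ t + k
window⁻ {k} {t} {j} = T-does⁻ (t ≤? j ×-dec j ≤? t + k)

binomialSum : ℕ → ℕ → ℕ → ℕ
binomialSum N t L = ∑[ x ∈ upTo L ] N C (t + x)

-- A chain with total gap `d` fits into the window iff its bottom is one of the lowest `k + 1 - d`
-- levels; for `d > k` the truncated difference correctly gives none.
∑-binomialSum : ∀ n d k t →
  ∑[ a ∈ upTo (suc n) ] (⟦ t ≤? a ⟧ * (⟦ a + d ≤? t + k ⟧ * (n ∸ d) C a)) ≡ binomialSum (n ∸ d) t (suc k ∸ d)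
∑-binomialSum n d k t = begin
  -- The window may reach above level `n`, so the range is first enlarged to contain both; the added
  -- terms vanish.
  ∑ (upTo (suc n)) φ                   ≡⟨ ∑-upTo-extend (suc n) (t + L) φ (λ {a} n<a → vanish a (trans
                                            (cong (⟦ a + d ≤? t + k ⟧ *_) (k>n⇒nCk≡0 (≤-<-trans (m∸n≤m n d) n<a))) (*-zeroʳ ⟦ a + d ≤? t + k ⟧))) ⟨
  ∑ (upTo (suc n + (t + L))) φ         ≡⟨ cong (λ m → ∑ (upTo m) φ) (trans (+-comm (suc n) (t + L)) (+-assoc t L (suc n))) ⟩
  ∑ (upTo (t + (L + suc n))) φ         ≡⟨ ∑-upTo-drop t (L + suc n) φ (λ {a} a<t → cong (_* (⟦ a + d ≤? t + k ⟧ * (n ∸ d) C a)) (⟦⟧≡0 (t ≤? a) (<⇒≱ a<t))) ⟩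
  ∑ (upTo (L + suc n)) (φ ∘ (t +_))    ≡⟨ ∑-upTo-extend L (suc n) (φ ∘ (t +_)) (λ {x} L≤x → vanish (t + x)
                                            (cong (_* (n ∸ d) C (t + x)) (⟦⟧≡0 (t + x + d ≤? t + k) (above x L≤x)))) ⟩
  ∑ (upTo L) (φ ∘ (t +_))              ≡⟨ ∑-cong (upTo L) (λ {x} x∈ → trans
                                            (cong₂ (λ i j → i * (j * (n ∸ d) C (t + x))) (⟦⟧≡1 (t ≤? t + x) (m≤m+n t x)) (⟦⟧≡1 (t + x + d ≤? t + k) (below x (∈-upTo⁻ x∈))))
                                            (trans (+-identityʳ _) (+-identityʳ _))) ⟩
  binomialSum (n ∸ d) t L              ∎
  where
  open ≡-Reasoning
  L = suc k ∸ d
  φ : ℕ → ℕ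
  φ a = ⟦ t ≤? a ⟧ * (⟦ a + d ≤? t + k ⟧ * (n ∸ d) C a)
  vanish : ∀ a → ⟦ a + d ≤? t + k ⟧ * (n ∸ d) C a ≡ 0 → φ a ≡ 0
  vanish a eq = trans (cong (⟦ t ≤? a ⟧ *_) eq) (*-zeroʳ ⟦ t ≤? a ⟧)
  above : ∀ x → L ≤ x → ¬ (t + x + d ≤ t + k)
  above x L≤x le = <⇒≱ (subst (suc k ≤_) (+-comm d x) (m∸n≤o⇒m≤n+o (suc k) d L≤x))
    (+-cancelˡ-≤ t (x + d) k (subst (_≤ t + k) (+-assoc t x d) le))
  below : ∀ x → x < L → t + x + d ≤ t + k
  below x x<L = subst (_≤ t + k) (sym (+-assoc t x d)) (+-monoʳ-≤ t (s≤s⁻¹ (m≤o∸n⇒m+n≤o (suc x) d≤1+k x<L)))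
    where d≤1+k = <⇒≤ (m∸n≢0⇒n<m (m<n⇒n≢0 x<L))

chainWeight-window : ∀ n m k t → chainWeight n (suc m) (window k t)
  ≡ ∑[ g ∈ vectors (upTo (suc n)) m ] (⟦ positive? g ⟧ * multinomial g * n C sum g * binomialSum (n ∸ sum g) t (suc k ∸ sum g))
chainWeight-window n m k t = begin
  chainWeight n (suc m) (window k t)
    ≡⟨ ∑-vectors-suc (upTo (suc n)) m (λ S → ⟦ levelChain? (window k t) S ⟧ * weight n 0 S) ⟩
  ∑ (upTo (suc n)) (λ a → ∑ V (λ S → ⟦ levelChain? (window k t) (a ∷ S) ⟧ * (n C a * weight n a S)))
    ≡⟨ ∑-cong (upTo (suc n)) (λ {a} a∈ → begin
         ∑ V (λ S → ⟦ levelChain? (window k t) (a ∷ S) ⟧ * (n C a * weight n a S))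
           ≡⟨ ∑-cong V (λ {S} _ → trans
                (cong (_* (n C a * weight n a S)) (⟦⟧-× (levelChain? (window k t) (a ∷ S)) (t ≤? a) (below? a S) lower (λ t≤a (lk , le) → raise t≤a lk le)))
                (rearrange₁ ⟦ t ≤? a ⟧ ⟦ below? a S ⟧ (n C a) (weight n a S))) ⟩
         ∑ V (λ S → ⟦ t ≤? a ⟧ * n C a * (⟦ below? a S ⟧ * weight n a S))
           ≡⟨ ∑-*ˡ V (⟦ t ≤? a ⟧ * n C a) _ ⟩
         ⟦ t ≤? a ⟧ * n C a * ∑ V (λ S → ⟦ below? a S ⟧ * weight n a S)
           ≡⟨ cong (⟦ t ≤? a ⟧ * n C a *_) (∑-above (t + k) m (s≤s⁻¹ (∈-upTo⁻ a∈))) ⟩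
         ⟦ t ≤? a ⟧ * n C a * ∑ V (λ g → ⟦ positive? g ⟧ * (⟦ a + sum g ≤? t + k ⟧ * ((n ∸ a) C sum g * multinomial g)))
           ≡⟨ ∑-*ˡ V (⟦ t ≤? a ⟧ * n C a) (λ g → ⟦ positive? g ⟧ * (⟦ a + sum g ≤? t + k ⟧ * ((n ∸ a) C sum g * multinomial g))) ⟨
         ∑ V (λ g → ⟦ t ≤? a ⟧ * n C a * (⟦ positive? g ⟧ * (⟦ a + sum g ≤? t + k ⟧ * ((n ∸ a) C sum g * multinomial g))))
           ≡⟨ ∑-cong V (λ {g} _ → begin
                ⟦ t ≤? a ⟧ * n C a * (⟦ positive? g ⟧ * (⟦ a + sum g ≤? t + k ⟧ * ((n ∸ a) C sum g * multinomial g)))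
                  ≡⟨ rearrange₂ ⟦ t ≤? a ⟧ (n C a) ⟦ positive? g ⟧ ⟦ a + sum g ≤? t + k ⟧ ((n ∸ a) C sum g) (multinomial g) ⟩
                ⟦ positive? g ⟧ * multinomial g * (⟦ t ≤? a ⟧ * (⟦ a + sum g ≤? t + k ⟧ * (n C a * (n ∸ a) C sum g)))
                  ≡⟨ cong (λ r → ⟦ positive? g ⟧ * multinomial g * (⟦ t ≤? a ⟧ * (⟦ a + sum g ≤? t + k ⟧ * r))) (C-swap n a (sum g)) ⟩
                ⟦ positive? g ⟧ * multinomial g * (⟦ t ≤? a ⟧ * (⟦ a + sum g ≤? t + k ⟧ * (n C sum g * (n ∸ sum g) C a)))
                  ≡⟨ rearrange₃ (⟦ positive? g ⟧ * multinomial g) ⟦ t ≤? a ⟧ ⟦ a + sum g ≤? t + k ⟧ (n C sum g) ((n ∸ sum g) C a) ⟩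
                scale g * φ g a ∎) ⟩
         ∑ V (λ g → scale g * φ g a) ∎) ⟩
  ∑ (upTo (suc n)) (λ a → ∑ V (λ g → scale g * φ g a))
    ≡⟨ ∑-comm (upTo (suc n)) V (λ a g → scale g * φ g a) ⟩
  ∑ V (λ g → ∑ (upTo (suc n)) (λ a → scale g * φ g a))
    ≡⟨ ∑-cong V (λ {g} _ → trans (∑-*ˡ (upTo (suc n)) (scale g) (φ g)) (cong (scale g *_) (∑-binomialSum n (sum g) k t))) ⟩
  ∑ V (λ g → scale g * binomialSum (n ∸ sum g) t (suc k ∸ sum g)) ∎
  where
  open ≡-Reasoning
  V = vectors (upTo (suc n)) m
  scale : Vec ℕ m → ℕ
  scale g = ⟦ positive? g ⟧ * multinomial g * n C sum g
  φ : Vec ℕ m → ℕ → ℕ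
  φ g a = ⟦ t ≤? a ⟧ * (⟦ a + sum g ≤? t + k ⟧ * (n ∸ sum g) C a)
  Below : ∀ {m} → ℕ → Vec ℕ m → Set
  Below a S = Linked _<_ (a ∷ S) × All (_≤ t + k) (a ∷ S)
  below? : ∀ {m} a (S : Vec ℕ m) → Dec (Below a S)
  below? a S = linked? _<?_ (a ∷ S) ×-dec all? (_≤? t + k) (a ∷ S)
  lower : ∀ {a m} {S : Vec ℕ m} → LevelChain (window k t) (a ∷ S) → t ≤ a × Below a S
  lower {a} (lk , ws@(w ∷ _)) = proj₁ (window⁻ {k} {t} {a} w) , lk , All.map (λ {j} w → proj₂ (window⁻ {k} {t} {j} w)) ws
  raise : ∀ {a m} {S : Vec ℕ m} → t ≤ a → Linked _<_ (a ∷ S) → All (_≤ t + k) (a ∷ S) → LevelChain (window k t) (a ∷ S)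
  raise t≤a [-] (le ∷ []) = [-] , window⁺ {k} t≤a le ∷ []
  raise {S = _ ∷ _} t≤a (a<b ∷ lk) (le ∷ les) with raise (≤-trans t≤a (<⇒≤ a<b)) lk les
  ... | lk , ws = a<b ∷ lk , window⁺ {k} t≤a le ∷ ws
  rearrange₁ : ∀ x y z w → x * y * (z * w) ≡ x * z * (y * w)
  rearrange₁ = solve-∀
  rearrange₂ : ∀ i c p j d μ → i * c * (p * (j * (d * μ))) ≡ p * μ * (i * (j * (c * d)))
  rearrange₂ = solve-∀
  rearrange₃ : ∀ p i j c d → p * (i * (j * (c * d))) ≡ p * c * (i * (j * d))
  rearrange₃ = solve-∀

-- Unimodality

-- Both sides add up the entries from `N C t` to `N C (t + L)`.
binomialSum-step : ∀ N t L → N C t + binomialSum N (suc t) L ≡ binomialSum N t L + N C (t + L)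
binomialSum-step N t L = begin
  N C t + binomialSum N (suc t) L                         ≡⟨ cong₂ _+_ (cong (N C_) (sym (+-identityʳ t))) (∑-cong (upTo L) (λ {x} _ → cong (N C_) (sym (+-suc t x)))) ⟩
  N C (t + 0) + ∑ (upTo L) (λ x → N C (t + suc x))        ≡⟨ ∑-upTo-suc L (λ x → N C (t + x)) ⟨
  ∑ (upTo (suc L)) (λ x → N C (t + x))                    ≡⟨ ∑-upTo-last L (λ x → N C (t + x)) ⟩
  binomialSum N t L + N C (t + L)                         ∎
  where open ≡-Reasoning

module _ (N t L : ℕ) where

  private
    step-≤ : ∀ {a b x y} → a + x ≡ y + b → a ≤ b → y ≤ x
    step-≤ {a} {b} {x} {y} eq a≤b = +-cancelʳ-≤ a y x (≤-trans (+-monoʳ-≤ y a≤b) (≤-reflexive (trans (sym eq) (+-comm a x))))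

    step-< : ∀ {a b x y} → a + x ≡ y + b → a < b → y < x
    step-< {a} {b} {x} {y} eq a<b = +-cancelʳ-< a y x (<-≤-trans (+-monoʳ-< y a<b) (≤-reflexive (trans (sym eq) (+-comm a x))))

    flip : N C (t + L) + binomialSum N t L ≡ binomialSum N (suc t) L + N C t
    flip = trans (+-comm (N C (t + L)) _) (trans (sym (binomialSum-step N t L)) (+-comm (N C t) _))

  binomialSum-≤ : N C t ≤ N C (t + L) → binomialSum N t L ≤ binomialSum N (suc t) L
  binomialSum-≤ = step-≤ (binomialSum-step N t L)

  binomialSum-< : N C t < N C (t + L) → binomialSum N t L < binomialSum N (suc t) L
  binomialSum-< = step-< (binomialSum-step N t L)

  binomialSum-≥ : N C (t + L) ≤ N C t → binomialSum N (suc t) L ≤ binomialSum N t L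
  binomialSum-≥ = step-≤ flip

  binomialSum-> : N C (t + L) < N C t → binomialSum N (suc t) L < binomialSum N t L
  binomialSum-> = step-< flip

window-∸ : ∀ t {k d} → d ≤ suc k → t + (t + suc k) ∸ d ≡ t + (t + (suc k ∸ d))
window-∸ t {k} d≤ = trans (+-∸-assoc t (≤-trans d≤ (m≤n+m (suc k) t))) (cong (t +_) (+-∸-assoc t d≤))

module _ {n k : ℕ} where

  binomialSum-up : ∀ {t} d → t + (t + suc k) ≤ n → binomialSum (n ∸ d) t (suc k ∸ d) ≤ binomialSum (n ∸ d) (suc t) (suc k ∸ d)
  binomialSum-up {t} d le with d ≤? suc k
  ... | yes d≤ = binomialSum-≤ (n ∸ d) t (suc k ∸ d) (C-mono (m≤m+n t _) (subst (_≤ n ∸ d) (window-∸ t d≤) (∸-monoˡ-≤ d le)))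
  ... | no d≰ rewrite m≤n⇒m∸n≡0 {suc k} {d} (<⇒≤ (≰⇒> d≰)) = z≤n

  binomialSum-down : ∀ {t} d → n ≤ t + (t + suc k) → binomialSum (n ∸ d) (suc t) (suc k ∸ d) ≤ binomialSum (n ∸ d) t (suc k ∸ d)
  binomialSum-down {t} d ge = binomialSum-≥ (n ∸ d) t (suc k ∸ d) (C-anti (m≤m+n t _) (m≤n+o⇒m∸n≤o n d (begin
    n                             ≤⟨ ge ⟩
    -- This bound also holds for a truncated difference, so `d > k + 1` needs no separate case.
    t + (t + suc k)               ≤⟨ +-monoʳ-≤ t (+-monoʳ-≤ t (m≤n+m∸n (suc k) d)) ⟩
    t + (t + (d + (suc k ∸ d)))   ≡⟨ rearrange t d (suc k ∸ d) ⟩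
    d + (t + (t + (suc k ∸ d)))   ∎)))
    where
    open ≤-Reasoning
    rearrange : ∀ t d l → t + (t + (d + l)) ≡ d + (t + (t + l))
    rearrange = solve-∀

  binomialSum-up-< : ∀ {t d} → d ≤ k → t + (t + suc k) < n → binomialSum (n ∸ d) t (suc k ∸ d) < binomialSum (n ∸ d) (suc t) (suc k ∸ d)
  binomialSum-up-< {t} {d} d≤k lt = binomialSum-< (n ∸ d) t (suc k ∸ d) (C-mono-< (m<m+n t (m<n⇒0<n∸m (s≤s d≤k)))
    (subst (_< n ∸ d) (window-∸ t (m≤n⇒m≤1+n d≤k))
      (∸-monoˡ-< lt (≤-trans (m≤n⇒m≤1+n d≤k) (≤-trans (m≤n+m (suc k) t) (m≤n+m _ t))))))

  binomialSum-down-< : ∀ {t d} → d ≤ k → d ≤ n → t ≤ n ∸ d → n < t + (t + suc k) →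
    binomialSum (n ∸ d) (suc t) (suc k ∸ d) < binomialSum (n ∸ d) t (suc k ∸ d)
  binomialSum-down-< {t} {d} d≤k d≤n t≤ gt = binomialSum-> (n ∸ d) t (suc k ∸ d) (C-anti-< t≤ (m<m+n t (m<n⇒0<n∸m (s≤s d≤k)))
    (subst (n ∸ d <_) (window-∸ t (m≤n⇒m≤1+n d≤k)) (∸-monoˡ-< gt d≤n)))

sum-ones : ∀ m → sum (replicate m 1) ≡ m
sum-ones zero = refl
sum-ones (suc m) = cong suc (sum-ones m)

multinomial>0 : ∀ {m} (g : Vec ℕ m) → 0 < multinomial g
multinomial>0 [] = z<s
multinomial>0 (x ∷ g) = *-mono-< (C>0 (m≤m+n x (sum g))) (multinomial>0 g)

module _ {n k m s t : ℕ} where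

  chainWeight-window-≤ : (∀ d → binomialSum (n ∸ d) s (suc k ∸ d) ≤ binomialSum (n ∸ d) t (suc k ∸ d)) →
    chainWeight n (suc m) (window k s) ≤ chainWeight n (suc m) (window k t)
  chainWeight-window-≤ le = subst₂ _≤_ (sym (chainWeight-window n m k s)) (sym (chainWeight-window n m k t))
    (∑-mono (vectors (upTo (suc n)) m) (λ {g} _ → *-monoʳ-≤ (⟦ positive? g ⟧ * multinomial g * n C sum g) (le (sum g))))

  -- The strict term is the all-ones gap vector, that of chains on consecutive levels, with sum `m`.
  -- Its coefficient is positive by `m ≤ n`, and `1 ≤ n` puts the entry 1 into the range of gaps.
  chainWeight-window-< : 1 ≤ n → m ≤ n → (∀ d → binomialSum (n ∸ d) s (suc k ∸ d) ≤ binomialSum (n ∸ d) t (suc k ∸ d)) →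
    binomialSum (n ∸ m) s (suc k ∸ m) < binomialSum (n ∸ m) t (suc k ∸ m) →
    chainWeight n (suc m) (window k s) < chainWeight n (suc m) (window k t)
  chainWeight-window-< 1≤n m≤n le lt = subst₂ _<_ (sym (chainWeight-window n m k s)) (sym (chainWeight-window n m k t))
    (∑-mono-< (vectors (upTo (suc n)) m) (λ {g} _ → *-monoʳ-≤ (⟦ positive? g ⟧ * multinomial g * n C sum g) (le (sum g)))
      (∈-vectors⁺ (all-replicate m (∈-upTo⁺ (s≤s 1≤n))))
      (*-monoʳ-< _ {{>-nonZero scale>0}} (subst (λ d → binomialSum (n ∸ d) s (suc k ∸ d) < binomialSum (n ∸ d) t (suc k ∸ d)) (sym (sum-ones m)) lt)))
    where
    all-replicate : ∀ {P : ℕ → Set} m → P 1 → All P (replicate m 1)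
    all-replicate zero p = []
    all-replicate (suc m) p = p ∷ all-replicate m p
    ones = replicate m 1
    scale>0 : 0 < ⟦ positive? ones ⟧ * multinomial ones * n C sum ones
    scale>0 = *-mono-< (*-mono-< (≤-reflexive (sym (⟦⟧≡1 (positive? ones) (all-replicate m z<s)))) (multinomial>0 ones))
      (C>0 (subst (_≤ n) (sym (sum-ones m)) m≤n))

-- The middle windows and their maximality

module Middle (n k : ℕ) where

  -- The bottom levels of the middle windows. For `k > n` truncation makes both 0, although the
  -- integer floor is negative; the families then consist of all subsets.
  lo hi : ℕ
  lo = ℕ.⌊ n ∸ k /2⌋
  hi = ℕ.⌈ n ∸ k /2⌉

  lo≤hi : lo ≤ hi
  lo≤hi = ⌊n/2⌋≤⌈n/2⌉ (n ∸ k)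

  hi≤1+lo : hi ≤ suc lo
  hi≤1+lo = ⌊n/2⌋-mono (n≤1+n (suc (n ∸ k)))

  lo+hi : lo + hi ≡ n ∸ k
  lo+hi = ⌊n/2⌋+⌈n/2⌉≡n (n ∸ k)

  -- A positive sum `lo + hi` forces `k < n`, where the subtraction is not truncated.
  lo+hi+k : 0 < lo + hi → lo + hi + k ≡ n
  lo+hi+k 0<lo+hi = trans (cong (_+ k) lo+hi) (m∸n+n≡m (<⇒≤ (m∸n≢0⇒n<m {n} {k} (m<n⇒n≢0 (subst (0 <_) lo+hi 0<lo+hi)))))

  -- In the second case the equation is the borderline of both monotonicity conditions, so the step
  -- from `lo` to `suc lo` changes nothing.
  hi≡lo⊎1+lo : hi ≡ lo ⊎ (hi ≡ suc lo × lo + (lo + suc k) ≡ n)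
  hi≡lo⊎1+lo with hi ≤? lo
  ... | yes hi≤lo = inj₁ (≤-antisym hi≤lo lo≤hi)
  ... | no hi≰lo = inj₂ (hi≡ , trans (rearrange lo k) (subst (λ h → lo + h + k ≡ n) hi≡
                     (lo+hi+k (≤-trans (<-≤-trans z<s (≰⇒> hi≰lo)) (m≤n+m hi lo)))))
    where
    hi≡ : hi ≡ suc lo
    hi≡ = ≤-antisym hi≤1+lo (≰⇒> hi≰lo)
    rearrange : ∀ l k → l + (l + suc k) ≡ l + suc l + k
    rearrange = solve-∀

  below-lo : ∀ {s} → s < lo → s + (s + suc k) < n
  below-lo {s} s<lo = subst (s + (s + suc k) <_) (lo+hi+k (≤-trans (<-≤-trans z<s s<lo) (m≤m+n lo hi)))
    (subst (_≤ lo + hi + k) (rearrange s k) (+-monoˡ-≤ k (+-mono-≤ s<lo (≤-trans s<lo lo≤hi))))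
    where
    rearrange : ∀ s k → suc s + suc s + k ≡ suc (s + (s + suc k))
    rearrange = solve-∀

  above-hi : ∀ {s} → hi ≤ s → n < s + (s + suc k)
  above-hi {s} hi≤s = subst (n <_) (rearrange s k) (s≤s (≤-trans (m≤n+m∸n n k)
    (+-monoʳ-≤ k (≤-trans (≤-reflexive (sym lo+hi)) (+-mono-≤ (≤-trans lo≤hi hi≤s) hi≤s)))))
    where
    rearrange : ∀ s k → suc (k + (s + s)) ≡ s + (s + suc k)
    rearrange = solve-∀

  module _ (m : ℕ) where

    private
      M : ℕ → ℕ
      M t = chainWeight n (suc m) (window k t)

      climb : ∀ {s t} → s ≤′ t → t ≤ lo → M s ≤ M t
      climb ≤′-refl _ = ≤-refl
      climb {s} (≤′-step {t} s≤t) t<lo = ≤-trans (climb s≤t (<⇒≤ t<lo))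
        (chainWeight-window-≤ {m = m} {t} (λ d → binomialSum-up {t = t} d (<⇒≤ (below-lo t<lo))))

      descend : ∀ {s t} → s ≤′ t → hi ≤ s → M t ≤ M s
      descend ≤′-refl _ = ≤-refl
      descend {s} (≤′-step {t} s≤t) hi≤s = ≤-trans
        (chainWeight-window-≤ {m = m} {suc t} (λ d → binomialSum-down {t = t} d (<⇒≤ (above-hi (≤-trans hi≤s (≤′⇒≤ s≤t))))))
        (descend s≤t hi≤s)

    chainWeight-hi≡lo : M hi ≡ M lo
    chainWeight-hi≡lo with hi≡lo⊎1+lo
    ... | inj₁ hi≡lo = cong M hi≡lo
    ... | inj₂ (hi≡1+lo , eq) = trans (cong M hi≡1+lo) (≤-antisym
      (chainWeight-window-≤ {m = m} {suc lo} (λ d → binomialSum-down {t = lo} d (≤-reflexive (sym eq))))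
      (chainWeight-window-≤ {m = m} {lo} (λ d → binomialSum-up {t = lo} d (≤-reflexive eq))))

    chainWeight-middle : ∀ s → M s ≤ M lo
    chainWeight-middle s with ≤-<-connex s lo
    ... | inj₁ s≤lo = climb (≤⇒≤′ s≤lo) ≤-refl
    ... | inj₂ lo<s = ≤-trans (descend (≤⇒≤′ (≤-trans hi≤1+lo lo<s)) ≤-refl) (≤-reflexive chainWeight-hi≡lo)

    chainWeight-middle-unique : 1 ≤ n → m ≤ k → m ≤ n → ∀ {s} → M lo ≤ M s → s ≡ lo ⊎ s ≡ hi
    chainWeight-middle-unique 1≤n m≤k m≤n {s} ge with ≤-<-connex lo s | ≤-<-connex s hi
    ... | inj₂ s<lo | _ = contradiction ge (<⇒≱ (<-≤-trans
      (chainWeight-window-< {m = m} {s} 1≤n m≤n (λ d → binomialSum-up {t = s} d (<⇒≤ (below-lo s<lo))) (binomialSum-up-< m≤k (below-lo s<lo)))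
      (climb (≤⇒≤′ s<lo) ≤-refl)))
    -- Only the first step above `hi` is claimed to be strict: there `hi ≤ n ∸ k ≤ n ∸ m` keeps the
    -- larger coefficient nonzero, whereas for much higher windows both may be 0.
    ... | inj₁ _ | inj₂ hi<s = contradiction ge (<⇒≱ (≤-<-trans
      (descend (≤⇒≤′ hi<s) (n≤1+n hi))
      (subst (M (suc hi) <_) chainWeight-hi≡lo
        (chainWeight-window-< {m = m} {suc hi} 1≤n m≤n (λ d → binomialSum-down {t = hi} d (<⇒≤ (above-hi ≤-refl)))
          (binomialSum-down-< m≤k m≤n (≤-trans (⌈n/2⌉≤n (n ∸ k)) (∸-monoʳ-≤ n m≤k)) (above-hi ≤-refl))))))
    ... | inj₁ lo≤s | inj₁ s≤hi with hi ≤? s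
    ...   | yes hi≤s = inj₂ (≤-antisym s≤hi hi≤s)
    ...   | no hi≰s = inj₁ (≤-antisym (s≤s⁻¹ (≤-trans (≰⇒> hi≰s) hi≤1+lo)) lo≤s)

private
  i<suc[j]⇒i≤j : ∀ {i j} → i ℤ.< ℤ.suc j → i ℤ.≤ j
  i<suc[j]⇒i≤j {i} {j} lt = subst (i ℤ.≤_) (ℤ.pred-suc j) (ℤ.i<j⇒i≤pred[j] lt)

-- Floors and ceilings of halves

-- This equivalence and the next three replace rounded halves by linear inequalities, without cases
-- for parity or sign.
floor-≤ : ∀ z {w} → ⌊ z /2⌋ ℤ.≤ w ⇔ z ℤ.< ℤ.suc w ℤ.* pos 2
floor-≤ z {w} = mk⇔
  (λ le → ℤ.<-≤-trans (n<s[n/ℕd]*d z 2) (ℤ.*-monoʳ-≤-nonNeg (pos 2) (ℤ.suc-mono le)))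
  (λ lt → i<suc[j]⇒i≤j (ℤ.*-cancelʳ-<-nonNeg (pos 2) (ℤ.≤-<-trans ([n/ℕd]*d≤n z 2) lt)))

≤-floor : ∀ z {w} → w ℤ.≤ ⌊ z /2⌋ ⇔ w ℤ.* pos 2 ℤ.≤ z
≤-floor z {w} = mk⇔
  (λ le → ℤ.≤-trans (ℤ.*-monoʳ-≤-nonNeg (pos 2) le) ([n/ℕd]*d≤n z 2))
  (λ le → i<suc[j]⇒i≤j (ℤ.*-cancelʳ-<-nonNeg (pos 2) (ℤ.≤-<-trans le (n<s[n/ℕd]*d z 2))))

ceiling-≤ : ∀ z {w} → ⌈ z /2⌉ ℤ.≤ w ⇔ z ℤ.≤ w ℤ.* pos 2
ceiling-≤ z {w} = mk⇔
  (λ le → ℤ.neg-cancel-≤ (subst (ℤ._≤ ℤ.- z) (sym (ℤ.neg-distribˡ-* w (pos 2)))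
    (to (≤-floor (ℤ.- z)) (subst (ℤ.- w ℤ.≤_) (ℤ.neg-involutive ⌊ ℤ.- z /2⌋) (ℤ.neg-mono-≤ le)))))
  (λ le → subst (⌈ z /2⌉ ℤ.≤_) (ℤ.neg-involutive w) (ℤ.neg-mono-≤
    (from (≤-floor (ℤ.- z)) (subst (ℤ._≤ ℤ.- z) (ℤ.neg-distribˡ-* w (pos 2)) (ℤ.neg-mono-≤ le)))))

≤-ceiling : ∀ z {w} → w ℤ.≤ ⌈ z /2⌉ ⇔ w ℤ.* pos 2 ℤ.< z ℤ.+ pos 2
≤-ceiling z {w} = mk⇔
  -- Here `z + 2 w` is added to both sides of `- z < 2 (1 - w)`.
  (λ le → subst₂ ℤ._<_ (left z w) (right z w) (ℤ.+-monoˡ-< (z ℤ.+ w ℤ.* pos 2)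
    (to (floor-≤ (ℤ.- z)) (subst (ℤ._≤ ℤ.- w) (ℤ.neg-involutive ⌊ ℤ.- z /2⌋) (ℤ.neg-mono-≤ le)))))
  (λ lt → subst (ℤ._≤ ⌈ z /2⌉) (ℤ.neg-involutive w) (ℤ.neg-mono-≤ (from (floor-≤ (ℤ.- z))
    (subst₂ ℤ._<_ (left′ z w) (right′ z w) (ℤ.+-monoˡ-< (ℤ.- (z ℤ.+ w ℤ.* pos 2)) lt)))))
  where
  left : ∀ z w → ℤ.- z ℤ.+ (z ℤ.+ w ℤ.* pos 2) ≡ w ℤ.* pos 2
  left = ℤ.solve-∀
  right : ∀ z w → (pos 1 ℤ.+ ℤ.- w) ℤ.* pos 2 ℤ.+ (z ℤ.+ w ℤ.* pos 2) ≡ z ℤ.+ pos 2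
  right = ℤ.solve-∀
  left′ : ∀ z w → w ℤ.* pos 2 ℤ.+ ℤ.- (z ℤ.+ w ℤ.* pos 2) ≡ ℤ.- z
  left′ = ℤ.solve-∀
  right′ : ∀ z w → z ℤ.+ pos 2 ℤ.+ ℤ.- (z ℤ.+ w ℤ.* pos 2) ≡ (pos 1 ℤ.+ ℤ.- w) ℤ.* pos 2
  right′ = ℤ.solve-∀

private
  i-k+k : ∀ i k → i ℤ.- k ℤ.+ k ≡ i
  i-k+k = ℤ.solve-∀
  i+k-k : ∀ i k → i ℤ.+ k ℤ.- k ≡ i
  i+k-k = ℤ.solve-∀

module _ (n k s : ℕ) where

  floor-difference : ⌊ pos n ℤ.- pos k /2⌋ ℤ.≤ pos s ⇔ n < suc s * 2 + k
  floor-difference = mk⇔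
    (λ le → ℤ.drop‿+<+ (subst₂ ℤ._<_ (i-k+k (pos n) (pos k)) (cong (ℤ._+ pos k) (sym (ℤ.pos-* (suc s) 2)))
      (ℤ.+-monoˡ-< (pos k) (to (floor-≤ (pos n ℤ.- pos k)) le))))
    (λ lt → from (floor-≤ (pos n ℤ.- pos k)) (subst (pos n ℤ.- pos k ℤ.<_) (trans (i+k-k (pos (suc s * 2)) (pos k)) (ℤ.pos-* (suc s) 2))
      (ℤ.+-monoˡ-< (ℤ.- pos k) (+<+ lt))))

  ceiling-difference : ⌈ pos n ℤ.- pos k /2⌉ ℤ.≤ pos s ⇔ n ≤ s * 2 + k
  ceiling-difference = mk⇔
    (λ le → ℤ.drop‿+≤+ (subst₂ ℤ._≤_ (i-k+k (pos n) (pos k)) (cong (ℤ._+ pos k) (sym (ℤ.pos-* s 2)))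
      (ℤ.+-monoˡ-≤ (pos k) (to (ceiling-≤ (pos n ℤ.- pos k)) le))))
    (λ le → from (ceiling-≤ (pos n ℤ.- pos k)) (subst (pos n ℤ.- pos k ℤ.≤_) (trans (i+k-k (pos (s * 2)) (pos k)) (ℤ.pos-* s 2))
      (ℤ.+-monoˡ-≤ (ℤ.- pos k) (+≤+ le))))

  floor-sum : pos s ℤ.≤ ⌊ pos n ℤ.+ pos k /2⌋ ⇔ s * 2 ≤ n + k
  floor-sum = mk⇔
    (λ le → ℤ.drop‿+≤+ (subst (ℤ._≤ pos (n + k)) (sym (ℤ.pos-* s 2)) (to (≤-floor (pos (n + k))) le)))
    (λ le → from (≤-floor (pos (n + k))) (subst (ℤ._≤ pos (n + k)) (ℤ.pos-* s 2) (+≤+ le)))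

  ceiling-sum : pos s ℤ.≤ ⌈ pos n ℤ.+ pos k /2⌉ ⇔ s * 2 < n + k + 2
  ceiling-sum = mk⇔
    (λ le → ℤ.drop‿+<+ (subst (ℤ._< pos (n + k + 2)) (sym (ℤ.pos-* s 2)) (to (≤-ceiling (pos (n + k))) le)))
    (λ lt → from (≤-ceiling (pos (n + k))) (subst (ℤ._< pos (n + k + 2)) (ℤ.pos-* s 2) (+<+ lt)))

-- The middle families as windows of sizes

module _ (n k : ℕ) where

  open Middle n k

  private
    n≤k+lo+hi : n ≤ k + (lo + hi)
    n≤k+lo+hi = ≤-trans (m≤n+m∸n n k) (≤-reflexive (cong (k +_) (sym lo+hi)))

  module _ {s : ℕ} where

    open ≤-Reasoning

    lo-≤ : lo ≤ s ⇔ n < suc s * 2 + k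
    lo-≤ = mk⇔
      (λ lo≤s → begin-strict
        n                   ≤⟨ n≤k+lo+hi ⟩
        k + (lo + hi)       ≤⟨ +-monoʳ-≤ k (+-mono-≤ lo≤s (≤-trans hi≤1+lo (s≤s lo≤s))) ⟩
        k + (s + suc s)     <⟨ n<1+n _ ⟩
        suc (k + (s + suc s)) ≡⟨ rearrange₁ k s ⟩
        suc s * 2 + k       ∎)
      (λ lt → ≮⇒≥ λ s<lo → <⇒≱ lt (subst (_≤ n) (rearrange₂ s k) (below-lo s<lo)))
      where
      rearrange₁ : ∀ k s → suc (k + (s + suc s)) ≡ suc s * 2 + k
      rearrange₁ = solve-∀
      rearrange₂ : ∀ s k → suc (s + (s + suc k)) ≡ suc s * 2 + k
      rearrange₂ = solve-∀

    hi-≤ : hi ≤ s ⇔ n ≤ s * 2 + k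
    hi-≤ = mk⇔
      (λ hi≤s → s≤s⁻¹ (subst (n <_) (rearrange₁ s k) (above-hi hi≤s)))
      (λ le → ≮⇒≥ λ s<hi → <⇒≱ (begin-strict
        s * 2 + k           <⟨ n<1+n _ ⟩
        suc (s * 2 + k)     ≡⟨ rearrange₂ s k ⟩
        s + suc s + k       ≤⟨ +-monoˡ-≤ k (+-mono-≤ (s≤s⁻¹ (≤-trans s<hi hi≤1+lo)) s<hi) ⟩
        lo + hi + k         ≡⟨ lo+hi+k (≤-trans (<-≤-trans z<s s<hi) (m≤n+m hi lo)) ⟩
        n                   ∎) le)
      where
      rearrange₁ : ∀ s k → s + (s + suc k) ≡ suc (s * 2 + k)
      rearrange₁ = solve-∀
      rearrange₂ : ∀ s k → suc (s * 2 + k) ≡ s + suc s + k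
      rearrange₂ = solve-∀

    private
      s≤k⇒s*2≤n+k : s ≤ n → s ≤ k → s * 2 ≤ n + k
      s≤k⇒s*2≤n+k s≤n s≤k = subst (_≤ n + k) (double s) (+-mono-≤ s≤n s≤k)
        where
        double : ∀ s → s + s ≡ s * 2
        double = solve-∀

      positive : ∀ {t} → k < s → s ≤ t + k → 0 < t
      positive {t} k<s s≤ = +-cancelʳ-< k 0 t (<-≤-trans k<s s≤)

    -- For `k > n` both sides hold thanks to `s ≤ n`. In the forward direction `s ≤ k` is settled by
    -- adding the two bounds on `s`, and `k < s ≤ lo + k` makes `lo` positive, which excludes
    -- truncation.
    ≤-lo+k : s ≤ n → s ≤ lo + k ⇔ s * 2 ≤ n + k
    ≤-lo+k s≤n = mk⇔ forward (λ le → ≮⇒≥ λ lt → <⇒≱ (begin-strict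
        n + k                       ≤⟨ +-monoˡ-≤ k n≤k+lo+hi ⟩
        k + (lo + hi) + k           ≤⟨ +-monoˡ-≤ k (+-monoʳ-≤ k (+-monoʳ-≤ lo hi≤1+lo)) ⟩
        k + (lo + suc lo) + k       <⟨ n<1+n _ ⟩
        suc (k + (lo + suc lo) + k) ≡⟨ rearrange₂ k lo ⟩
        suc (lo + k) * 2            ≤⟨ *-monoˡ-≤ 2 lt ⟩
        s * 2                       ∎) le)
      where
      rearrange₁ : ∀ l k → (l + k) * 2 ≡ l + l + k + k
      rearrange₁ = solve-∀
      rearrange₂ : ∀ k l → suc (k + (l + suc l) + k) ≡ suc (l + k) * 2
      rearrange₂ = solve-∀
      forward : s ≤ lo + k → s * 2 ≤ n + k
      forward le with ≤-<-connex s k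
      ... | inj₁ s≤k = s≤k⇒s*2≤n+k s≤n s≤k
      ... | inj₂ k<s = begin
        s * 2               ≤⟨ *-monoˡ-≤ 2 le ⟩
        (lo + k) * 2        ≡⟨ rearrange₁ lo k ⟩
        lo + lo + k + k     ≤⟨ +-monoˡ-≤ k (+-monoˡ-≤ k (+-monoʳ-≤ lo lo≤hi)) ⟩
        lo + hi + k + k     ≡⟨ cong (_+ k) (lo+hi+k (≤-trans (positive k<s le) (m≤m+n lo hi))) ⟩
        n + k               ∎

    ≤-hi+k : s ≤ n → s ≤ hi + k ⇔ s * 2 < n + k + 2
    ≤-hi+k s≤n = mk⇔ forward (λ lt → ≮⇒≥ λ gt → <⇒≱ lt (begin
        n + k + 2                   ≤⟨ +-monoˡ-≤ 2 (+-monoˡ-≤ k n≤k+lo+hi) ⟩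
        k + (lo + hi) + k + 2       ≤⟨ +-monoˡ-≤ 2 (+-monoˡ-≤ k (+-monoʳ-≤ k (+-monoˡ-≤ hi lo≤hi))) ⟩
        k + (hi + hi) + k + 2       ≡⟨ rearrange₂ k hi ⟩
        suc (hi + k) * 2            ≤⟨ *-monoˡ-≤ 2 gt ⟩
        s * 2                       ∎))
      where
      rearrange₁ : ∀ h k → suc ((h + k) * 2) ≡ suc (h + h + k + k)
      rearrange₁ = solve-∀
      rearrange₂ : ∀ k h → k + (h + h) + k + 2 ≡ suc (h + k) * 2
      rearrange₂ = solve-∀
      rearrange₃ : ∀ l h k → suc (suc l + h + k + k) ≡ l + h + k + k + 2
      rearrange₃ = solve-∀
      forward : s ≤ hi + k → s * 2 < n + k + 2
      forward le with ≤-<-connex s k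
      ... | inj₁ s≤k = ≤-<-trans (s≤k⇒s*2≤n+k s≤n s≤k) (m<m+n (n + k) z<s)
      ... | inj₂ k<s = begin
        suc (s * 2)               ≤⟨ s≤s (*-monoˡ-≤ 2 le) ⟩
        suc ((hi + k) * 2)        ≡⟨ rearrange₁ hi k ⟩
        suc (hi + hi + k + k)     ≤⟨ s≤s (+-monoˡ-≤ k (+-monoˡ-≤ k (+-monoˡ-≤ hi hi≤1+lo))) ⟩
        suc (suc lo + hi + k + k) ≡⟨ rearrange₃ lo hi k ⟩
        lo + hi + k + k + 2       ≡⟨ cong (λ m → m + k + 2) (lo+hi+k (≤-trans (positive k<s le) (m≤n+m hi lo))) ⟩
        n + k + 2                 ∎

  T-layers : ∀ {a b} (X : Subset n) → T (layers a b X) ⇔ (a ℤ.≤ pos ∣ X ∣ × pos ∣ X ∣ ℤ.≤ b)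
  T-layers {a} {b} X = mk⇔ (T-does⁻ d) (T-does⁺ d)
    where d = a ℤ.≤? pos ∣ X ∣ ×-dec pos ∣ X ∣ ℤ.≤? b

  lowerMiddle⇔window : (X : Subset n) → T (lowerMiddle n k X) ⇔ T (window k lo ∣ X ∣)
  lowerMiddle⇔window X = mk⇔
    (λ X∈ → let a , b = to (T-layers X) X∈ in window⁺ {k} {lo} {∣ X ∣}
      (from lo-≤ (to (floor-difference n k ∣ X ∣) a)) (from (≤-lo+k (∣p∣≤n X)) (to (floor-sum n k ∣ X ∣) b)))
    (λ X∈ → let a , b = window⁻ {k} {lo} {∣ X ∣} X∈ in from (T-layers X)
      (from (floor-difference n k ∣ X ∣) (to lo-≤ a) , from (floor-sum n k ∣ X ∣) (to (≤-lo+k (∣p∣≤n X)) b)))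

  upperMiddle⇔window : (X : Subset n) → T (upperMiddle n k X) ⇔ T (window k hi ∣ X ∣)
  upperMiddle⇔window X = mk⇔
    (λ X∈ → let a , b = to (T-layers X) X∈ in window⁺ {k} {hi} {∣ X ∣}
      (from hi-≤ (to (ceiling-difference n k ∣ X ∣) a)) (from (≤-hi+k (∣p∣≤n X)) (to (ceiling-sum n k ∣ X ∣) b)))
    (λ X∈ → let a , b = window⁻ {k} {hi} {∣ X ∣} X∈ in from (T-layers X)
      (from (ceiling-difference n k ∣ X ∣) (to hi-≤ a) , from (ceiling-sum n k ∣ X ∣) (to (≤-hi+k (∣p∣≤n X)) b)))

-- Optimal families

T-injective : ∀ {a b} → T a ⇔ T b → a ≡ b
T-injective {true}  {true}  _ = refl
T-injective {true}  {false} a⇔b with () ← to a⇔b _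
T-injective {false} {true}  a⇔b with () ← from a⇔b _
T-injective {false} {false} _ = refl

T-false : ∀ {a} → ¬ T a → a ≡ false
T-false {false} _ = refl
T-false {true} ¬t = contradiction _ ¬t

least : (f : ℕ → Bool) (N : ℕ) → (∀ {j} → j < N → ¬ T (f j)) ⊎ ∃ λ t → t < N × T (f t) × (∀ {j} → T (f j) → t ≤ j)
least f zero = inj₁ λ ()
least f (suc N) with least f N
... | inj₂ (t , t<N , ft , minimal) = inj₂ (t , m<n⇒m<1+n t<N , ft , minimal)
... | inj₁ none with T? (f N)
...   | yes fN = inj₂ (N , n<1+n N , fN , λ fj → ≮⇒≥ λ j<N → none j<N fj)
...   | no ¬fN = inj₁ λ {j} j<1+N fj → case-≤ (m≤n⇒m<n∨m≡n (s≤s⁻¹ j<1+N)) fj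
  where
  case-≤ : ∀ {j} → j < N ⊎ j ≡ N → ¬ T (f j)
  case-≤ (inj₁ j<N) = none j<N
  case-≤ (inj₂ refl) = ¬fN

module _ {n k : ℕ} {F : Family n} where

  admissible-window : ∀ {t} → (∀ X → T (F X) ⇔ T (window k t ∣ X ∣)) → Admissible k F
  admissible-window {t} F⇔ A B A∈F B∈F (A⊆B , B─A>k) = <⇒≱ (+-mono-≤ B─A>k t≤A)
    (≤-trans (≤-reflexive (∣─∣ A B A⊆B)) (≤-trans B≤t+k (≤-reflexive (+-comm t k))))
    where
    t≤A = proj₁ (window⁻ {k} {t} {∣ A ∣} (to (F⇔ A) A∈F))
    B≤t+k = proj₂ (window⁻ {k} {t} {∣ B ∣} (to (F⇔ B) B∈F))

  #chains-window : ∀ {t} ℓ → (∀ X → T (F X) ⇔ T (window k t ∣ X ∣)) →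
    n ! * #chains ℓ F ≡ ∑[ c ∈ fullChains n ] chainWeight n ℓ (window k t)
  #chains-window {t} ℓ F⇔ = trans (#chains-fullChains ℓ F) (∑-cong (fullChains n) λ {c} c∈ → chainWeight-cong {ℓ = ℓ}
    (λ {j} j≤n Fj → subst (T ∘ window k t) (∣level∣ c∈ j≤n) (to (F⇔ (level c j)) Fj))
    (λ {j} j≤n wj → from (F⇔ (level c j)) (subst (T ∘ window k t) (sym (∣level∣ c∈ j≤n)) wj)))

  -- The window starts at the least level `t` where the chain meets `F`: a member above level
  -- `t + k` would form a forbidden pair with it. If the chain misses `F`, any window will do, here
  -- the one at 0.
  level-window : Admissible k F → ∀ {c} → c ∈ fullChains n →
    ∃ λ t → ∀ {j} → j ≤ n → T (F (level c j)) → T (window k t j)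
  level-window adm {c} c∈ with least (F ∘ level c) (suc n)
  ... | inj₁ none = 0 , λ j≤n Fj → contradiction Fj (none (s≤s j≤n))
  ... | inj₂ (t , t≤n , Ft , minimal) = t , λ {j} j≤n Fj → window⁺ {k} {t} {j} (minimal Fj) (≮⇒≥ λ t+k<j →
    let X⊆Y = level-⊆ c (minimal Fj) in
    adm (level c t) (level c j) Ft Fj (X⊆Y , +-cancelʳ-< t k (∣ level c j ─ level c t ∣) (subst₂ _<_ (+-comm t k)
      (trans (sym (∣level∣ c∈ j≤n)) (trans (sym (∣─∣ (level c t) (level c j) X⊆Y)) (cong (∣ level c j ─ level c t ∣ +_) (∣level∣ c∈ (s≤s⁻¹ t≤n)))))
      t+k<j)))

-- Takes the bottom level `t` and continues from `t + 1`, still aiming at `j` unless `t` was `j`;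
-- the last free place goes to the target. That `j` is an entry of `S` is expressed by its
-- inheriting every property common to the entries.
chain-through : ∀ m {t u j} → t + m ≤ u → t ≤ j → j ≤ u →
  ∃ λ (S : Vec ℕ (suc m)) → Linked _<_ S × All (t ≤_) S × All (_≤ u) S × (∀ {P : ℕ → Set} → All P S → P j)
chain-through zero {j = j} _ t≤j j≤u = j ∷ [] , [-] , t≤j ∷ [] , j≤u ∷ [] , All.head
chain-through (suc m) {t} {u} {j} t+m≤u t≤j j≤u with m≤n⇒m<n∨m≡n t≤j
... | inj₁ t<j with chain-through m (subst (_≤ u) (+-suc t m) t+m≤u) t<j j≤u
...   | S@(_ ∷ _) , lk , t<S@(t<s ∷ _) , S≤u , Pj =
  t ∷ S , t<s ∷ lk , ≤-refl ∷ All.map <⇒≤ t<S , ≤-trans t≤j j≤u ∷ S≤u , Pj ∘ All.tail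
chain-through (suc m) {t} {u} {j} t+m≤u t≤j j≤u | inj₂ refl
  with chain-through m (subst (_≤ u) (+-suc t m) t+m≤u) ≤-refl (m+n≤o⇒m≤o (suc t) (subst (_≤ u) (+-suc t m) t+m≤u))
...   | S@(_ ∷ _) , lk , t<S@(t<s ∷ _) , S≤u , _ = t ∷ S , t<s ∷ lk , ≤-refl ∷ All.map <⇒≤ t<S , j≤u ∷ S≤u , All.head

-- Sets of equal size are connected by adjacent transpositions, and both ends of such a step lie in
-- a common set with one more element.
data _⇝_ : ∀ {n} → Subset n → Subset n → Set where
  swap : ∀ {n} {X : Subset n} → (outside ∷ inside ∷ X) ⇝ (inside ∷ outside ∷ X)
  skip : ∀ {n b} {X Y : Subset n} → X ⇝ Y → (b ∷ X) ⇝ (b ∷ Y)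

∣⇝∣ : ∀ {n} {X Y : Subset n} → X ⇝ Y → ∣ X ∣ ≡ ∣ Y ∣
∣⇝∣ swap = refl
∣⇝∣ (skip {b = inside} X⇝Y) = cong suc (∣⇝∣ X⇝Y)
∣⇝∣ (skip {b = outside} X⇝Y) = ∣⇝∣ X⇝Y

⇝-join : ∀ {n} {X Y : Subset n} → X ⇝ Y → ∃ λ Z → X ⊆ Z × Y ⊆ Z × ∣ Z ∣ ≡ suc ∣ X ∣
⇝-join {X = _ ∷ _ ∷ X} swap = inside ∷ inside ∷ X , out⊆ ⊆-refl , in⊆in (out⊆ ⊆-refl) , refl
⇝-join {X = _ ∷ X} (skip {b = b} X⇝Y) with ⇝-join X⇝Y
... | Z , X⊆Z , Y⊆Z , eq = b ∷ Z , s⊆s X⊆Z , s⊆s Y⊆Z , size b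
  where
  size : ∀ b → ∣ b ∷ Z ∣ ≡ suc ∣ b ∷ X ∣
  size inside = cong suc eq
  size outside = eq

initial : ∀ n → ℕ → Subset n
initial zero s = []
initial (suc n) zero = outside ∷ initial n zero
initial (suc n) (suc s) = inside ∷ initial n s

-- The leading `outside` moves to the right past the `s` elements, one transposition at a time.
outside∷initial : ∀ n {s} → s ≤ n → Star _⇝_ (outside ∷ initial n s) (initial (suc n) s)
outside∷initial n {zero} _ = ε
outside∷initial (suc n) {suc s} (s≤s s≤n) = swap ◅ gmap (inside ∷_) skip (outside∷initial n s≤n)

⇝-initial : ∀ {n} (X : Subset n) → Star _⇝_ X (initial n ∣ X ∣)
⇝-initial [] = ε
⇝-initial (inside ∷ X) = gmap (inside ∷_) skip (⇝-initial X)
⇝-initial (outside ∷ X) = gmap (outside ∷_) skip (⇝-initial X) ◅◅ outside∷initial _ (∣p∣≤n X)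

⇝-invariant : ∀ {n s} {F : Family n} → (∀ {X Y} → X ⇝ Y → ∣ X ∣ ≡ s → F X ≡ F Y) →
  ∀ X Y → ∣ X ∣ ≡ s → ∣ Y ∣ ≡ s → F X ≡ F Y
⇝-invariant {n} {s} {F} inv X Y X≡s Y≡s = trans (to-initial X X≡s) (sym (to-initial Y Y≡s))
  where
  along : ∀ {X Y} → Star _⇝_ X Y → ∣ X ∣ ≡ s → F X ≡ F Y
  along ε _ = refl
  along (X⇝Z ◅ Z⇝Y) eq = trans (inv X⇝Z eq) (along Z⇝Y (trans (sym (∣⇝∣ X⇝Z)) eq))
  to-initial : ∀ X → ∣ X ∣ ≡ s → F X ≡ F (initial n s)
  to-initial X refl = along (⇝-initial X) refl

-- The upper bound and the case of equality

module _ (n k m : ℕ) where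

  open Middle n k

  private
    M : ℕ → ℕ
    M t = chainWeight n (suc m) (window k t)

    instance
      n!≢0 : NonZero (n !)
      n!≢0 = n !≢0

  #chains-≤ : ∀ {F} → Admissible k F → n ! * #chains (suc m) F ≤ ∑[ c ∈ fullChains n ] M lo
  #chains-≤ {F} adm = ≤-trans (≤-reflexive (#chains-fullChains (suc m) F))
    (∑-mono (fullChains n) λ c∈ → let t , inside-t = level-window adm c∈ in
      ≤-trans (chainWeight-mono {ℓ = suc m} inside-t) (chainWeight-middle m t))

  window-mostChains : ∀ {F t} → M t ≡ M lo → (∀ X → T (F X) ⇔ T (window k t ∣ X ∣)) → ContainsMostChains k (suc m) F
  window-mostChains {F} {t} Mt≡ F⇔ = admissible-window {t = t} F⇔ , λ F′ adm → *-cancelˡ-≤ (n !) (≤-trans (#chains-≤ adm)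
    (≤-reflexive (sym (trans (#chains-window {t = t} (suc m) F⇔) (∑-cong (fullChains n) λ _ → Mt≡)))))

  lowerMiddle-mostChains : ContainsMostChains k (suc m) (lowerMiddle n k)
  lowerMiddle-mostChains = window-mostChains {t = lo} refl (lowerMiddle⇔window n k)

  upperMiddle-mostChains : ContainsMostChains k (suc m) (upperMiddle n k)
  upperMiddle-mostChains = window-mostChains {t = hi} (chainWeight-hi≡lo m) (upperMiddle⇔window n k)

  module Optimal (1≤n : 1 ≤ n) (m≤k : m ≤ k) (m≤n : m ≤ n) {F : Family n} (most : ContainsMostChains k (suc m) F) where

    private
      Fills : ℕ → Vec ℕ n → Set
      Fills t c = ∀ j → j ≤ n → T (F (level c j)) ⇔ T (window k t j)

      -- Guarantees `m + 1` levels between the bottom of a middle window and level `n`, even if the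
      -- window reaches beyond `n`.
      hi+m≤n : hi + m ≤ n
      hi+m≤n with ≤-total k n
      ... | inj₁ k≤n = ≤-trans (+-mono-≤ (m+n≤o⇒n≤o lo (≤-reflexive lo+hi)) m≤k) (≤-reflexive (m∸n+n≡m k≤n))
      ... | inj₂ n≤k = subst (λ h → h + m ≤ n) (sym (n≤0⇒n≡0 (m+n≤o⇒n≤o lo (≤-reflexive (trans lo+hi (m≤n⇒m∸n≡0 n≤k)))))) m≤n

      -- By tightness every level chain of length `m + 1` in the window, cut off at `n`, lies in
      -- `F`; and every level of the cut window is on such a level chain.
      fills-mono : ∀ {c t} → M t ≡ M lo → t ≤ hi → chainWeight n (suc m) (F ∘ level c) ≡ M lo →
        (∀ {j} → j ≤ n → T (F (level c j)) → T (window k t j)) → Fills t c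
      fills-mono {c} {t} Mt≡ t≤hi W≡ F⇒w j j≤n = mk⇔ (F⇒w j≤n) λ wj →
        let t≤j , j≤t+k = window⁻ {k} {t} {j} wj
            S , lk , t≤S , S≤u , Pj = chain-through m {t} {(t + k) ⊓ n} (⊓-glb (+-monoʳ-≤ t m≤k) (≤-trans (+-monoˡ-≤ m t≤hi) hi+m≤n)) t≤j (⊓-glb j≤t+k j≤n)
            S-window = All.map (λ {i} (t≤i , i≤u) → window⁺ {k} {t} {i} t≤i (m≤n⊓o⇒m≤n (t + k) n i≤u)) (All.zip (t≤S , S≤u))
        in Pj (proj₂ (chainWeight-tight F⇒w (≤-reflexive (trans Mt≡ (sym W≡))) (All.map (m≤n⊓o⇒m≤o (t + k) n) S≤u) (lk , S-window)))

    -- No full chain weighs more than `M lo`, and optimality makes the total at least that of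
    -- `lowerMiddle`. So each weighs exactly `M lo`, which forces its window to be a middle one.
    fills : ∀ {c} → c ∈ fullChains n → Fills lo c ⊎ Fills hi c
    fills {c} c∈ = let t , F⇒w = level-window (proj₁ most) c∈ in
      result F⇒w (≤-antisym (chainWeight-middle m t) (≤-trans (≤-reflexive (sym W≡)) (chainWeight-mono {ℓ = suc m} F⇒w)))
      where
      W≡ : chainWeight n (suc m) (F ∘ level c) ≡ M lo
      W≡ = ∑-tight (fullChains n)
        (λ c∈ → let t , F⇒w = level-window (proj₁ most) c∈ in ≤-trans (chainWeight-mono {ℓ = suc m} F⇒w) (chainWeight-middle m t))
        (begin
          ∑ (fullChains n) (λ _ → M lo)                                 ≡⟨ #chains-window {t = lo} (suc m) (lowerMiddle⇔window n k) ⟨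
          n ! * #chains (suc m) (lowerMiddle n k)                       ≤⟨ *-monoʳ-≤ (n !) (proj₂ most _ (proj₁ lowerMiddle-mostChains)) ⟩
          n ! * #chains (suc m) F                                       ≡⟨ #chains-fullChains (suc m) F ⟩
          ∑ (fullChains n) (λ c → chainWeight n (suc m) (F ∘ level c))  ∎)
        c∈
        where open ≤-Reasoning
      result : ∀ {t} → (∀ {j} → j ≤ n → T (F (level c j)) → T (window k t j)) → M t ≡ M lo → Fills lo c ⊎ Fills hi c
      result {t} F⇒w Mt≡ with chainWeight-middle-unique m 1≤n m≤k m≤n (≤-reflexive (sym Mt≡))
      ... | inj₁ refl = inj₁ (fills-mono {c} refl lo≤hi W≡ F⇒w)
      ... | inj₂ refl = inj₂ (fills-mono {c} Mt≡ ≤-refl W≡ F⇒w)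

    private
      uniform : ∀ {t} → (∀ {c} → c ∈ fullChains n → Fills t c) → ∀ X → T (F X) ⇔ T (window k t ∣ X ∣)
      uniform {t} all X with through X X ⊆-refl
      ... | c , c∈ , cX , _ = subst (λ Y → T (F Y) ⇔ T (window k t ∣ X ∣)) cX (all c∈ (∣ X ∣) (∣p∣≤n X))

      as-lower : (∀ {c} → c ∈ fullChains n → Fills lo c) → F ≗ lowerMiddle n k
      as-lower all X = T-injective (mk⇔ (from (lowerMiddle⇔window n k X) ∘ to (uniform all X)) (from (uniform all X) ∘ to (lowerMiddle⇔window n k X)))

      as-upper : (∀ {c} → c ∈ fullChains n → Fills hi c) → F ≗ upperMiddle n k
      as-upper all X = T-injective (mk⇔ (from (upperMiddle⇔window n k X) ∘ to (uniform all X)) (from (uniform all X) ∘ to (upperMiddle⇔window n k X)))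

    -- If n ∸ k is odd, a full chain meets F in exactly one of the levels lo and suc lo + k. Members of
    -- level lo below a common member of level suc lo + k are therefore both in F or both not in F.
    module TwoWindows (hi≡ : hi ≡ suc lo) (n≡ : lo + (lo + suc k) ≡ n) where

      private
        top : ℕ
        top = suc lo + k

        top≤n : top ≤ n
        top≤n = subst₂ _≤_ (+-suc lo k) n≡ (m≤n+m (lo + suc k) lo)

        1+lo≤top : suc lo ≤ top
        1+lo≤top = m≤m+n (suc lo) k

        lo≤n : lo ≤ n
        lo≤n = ≤-trans (≤-trans (n≤1+n lo) 1+lo≤top) top≤n

        lo∈lo : T (window k lo lo)
        lo∈lo = window⁺ {k} {lo} {lo} ≤-refl (m≤m+n lo k)

        top∉lo : ¬ T (window k lo top)
        top∉lo w = <⇒≱ (n<1+n (lo + k)) (proj₂ (window⁻ {k} {lo} {top} w))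

        lo∉hi : ¬ T (window k hi lo)
        lo∉hi w = <⇒≱ (≤-reflexive (sym hi≡)) (proj₁ (window⁻ {k} {hi} {lo} w))

        top∈hi : T (window k hi top)
        top∈hi = subst (λ h → T (window k h top)) (sym hi≡) (window⁺ {k} {suc lo} {top} 1+lo≤top ≤-refl)

      exactly-one : ∀ X W → X ⊆ W → ∣ X ∣ ≡ lo → ∣ W ∣ ≡ top → F X ≡ not (F W)
      exactly-one X W X⊆W X≡ W≡ with through X W X⊆W
      ... | c , c∈ , cX , cW with fills c∈
      ...   | inj₁ f = trans
        (to T-≡ (subst (T ∘ F) (trans (cong (level c) (sym X≡)) cX) (from (f lo lo≤n) lo∈lo)))
        (cong not (sym (T-false λ FW → top∉lo (to (f top top≤n) (subst (T ∘ F) (trans (sym cW) (cong (level c) W≡)) FW)))))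
      ...   | inj₂ f = trans
        (T-false λ FX → lo∉hi (to (f lo lo≤n) (subst (T ∘ F) (trans (sym cX) (cong (level c) X≡)) FX)))
        (cong not (sym (to T-≡ (subst (T ∘ F) (trans (cong (level c) (sym W≡)) cW) (from (f top top≤n) top∈hi)))))

      swap-invariant : ∀ {X Y} → X ⇝ Y → ∣ X ∣ ≡ lo → F X ≡ F Y
      swap-invariant {X} {Y} X⇝Y X≡ with ⇝-join X⇝Y
      ... | Z , X⊆Z , Y⊆Z , Z≡ with through Z Z ⊆-refl
      ...   | c , c∈ , cZ , _ = trans (exactly-one X W (Z⊆W ∘ X⊆Z) X≡ (∣level∣ c∈ top≤n))
        (sym (exactly-one Y W (Z⊆W ∘ Y⊆Z) (trans (sym (∣⇝∣ X⇝Y)) X≡) (∣level∣ c∈ top≤n)))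
        where
        -- `Z` has `lo + 1 ≤ top` elements, so a full chain through `Z` supplies a set of size `top`
        -- above both `X` and `Y`.
        W = level c top
        Z⊆W : Z ⊆ W
        Z⊆W = subst (_⊆ W) cZ (level-⊆ c (subst (_≤ top) (sym (trans Z≡ (cong suc X≡))) 1+lo≤top))

      unique-of-two : F ≗ lowerMiddle n k ⊎ F ≗ upperMiddle n k
      -- This yields some full chain for reference. Its member of size `lo` decides for all sets of
      -- that size, and thereby which window every full chain fills.
      unique-of-two with through ⊥ ⊥ ⊆-refl
      ... | c₀ , c₀∈ , _ with T? (F (level c₀ lo))
      ...   | yes F₀ = inj₁ (as-lower λ {c} c∈ → fills-lo c∈ (fills c∈))
        where
        fills-lo : ∀ {c} → c ∈ fullChains n → Fills lo c ⊎ Fills hi c → Fills lo c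
        fills-lo _ (inj₁ f) = f
        fills-lo {c} c∈ (inj₂ f) = contradiction (to (f lo lo≤n) (subst T
          (⇝-invariant swap-invariant (level c₀ lo) (level c lo) (∣level∣ c₀∈ lo≤n) (∣level∣ c∈ lo≤n)) F₀)) lo∉hi
      ...   | no ¬F₀ = inj₂ (as-upper λ {c} c∈ → fills-hi c∈ (fills c∈))
        where
        fills-hi : ∀ {c} → c ∈ fullChains n → Fills lo c ⊎ Fills hi c → Fills hi c
        fills-hi _ (inj₂ f) = f
        fills-hi {c} c∈ (inj₁ f) = contradiction (subst T
          (⇝-invariant swap-invariant (level c lo) (level c₀ lo) (∣level∣ c∈ lo≤n) (∣level∣ c₀∈ lo≤n)) (from (f lo lo≤n) lo∈lo)) ¬F₀

    unique : F ≗ lowerMiddle n k ⊎ F ≗ upperMiddle n k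
    unique with hi≡lo⊎1+lo
    ... | inj₂ (hi≡ , n≡) = TwoWindows.unique-of-two hi≡ n≡
    ... | inj₁ hi≡lo = inj₁ (as-lower λ {c} c∈ → fills-lo {c} (fills c∈))
      where
      fills-lo : ∀ {c} → Fills lo c ⊎ Fills hi c → Fills lo c
      fills-lo (inj₁ f) = f
      fills-lo {c} (inj₂ f) = subst (λ t → Fills t c) hi≡lo f

lowerMiddle≗upperMiddle : ∀ n k → 2 ∣ n + k → lowerMiddle n k ≗ upperMiddle n k
lowerMiddle≗upperMiddle n k 2∣n+k X with Middle.hi≡lo⊎1+lo n k
... | inj₁ hi≡lo = T-injective (mk⇔
  (from (upperMiddle⇔window n k X) ∘ subst (λ t → T (window k t ∣ X ∣)) (sym hi≡lo) ∘ to (lowerMiddle⇔window n k X))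
  (from (lowerMiddle⇔window n k X) ∘ subst (λ t → T (window k t ∣ X ∣)) hi≡lo ∘ to (upperMiddle⇔window n k X)))
-- Two different windows would give `n + k = 2 (lo + k) + 1`, an odd number.
... | inj₂ (_ , n≡) = contradiction (∣1⇒≡1 (∣m+n∣m⇒∣n (subst (2 ∣_) (trans (cong (_+ k) (sym n≡)) (rearrange lo k)) 2∣n+k)
  (divides (lo + k) refl))) λ ()
  where
  open Middle n k
  rearrange : ∀ l k → l + (l + suc k) + k ≡ (l + k) * 2 + 1
  rearrange = solve-∀

theorem5p5 : ∀ (n k ℓ : ℕ) → 1 ≤ n → 1 ≤ ℓ → ℓ ≤ k + 1 →
    ContainsMostChains k ℓ (lowerMiddle n k)
    × ContainsMostChains k ℓ (upperMiddle n k)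
    × (ℓ ≤ n + 1 → ∀ (F : Family n) → ContainsMostChains k ℓ F →
    F ≗ lowerMiddle n k ⊎ F ≗ upperMiddle n k)
    × (2 ∣ n + k → lowerMiddle n k ≗ upperMiddle n k)
theorem5p5 n k (suc m) 1≤n _ ℓ≤k+1 =
    lowerMiddle-mostChains n k m
  , upperMiddle-mostChains n k m
  , (λ ℓ≤n+1 F most → Optimal.unique n k m 1≤n (pred-≤ ℓ≤k+1) (pred-≤ ℓ≤n+1) most)
  , lowerMiddle≗upperMiddle n k
  where
  pred-≤ : ∀ {a} → suc m ≤ a + 1 → m ≤ a
  pred-≤ {a} le = s≤s⁻¹ (subst (suc m ≤_) (+-comm a 1) le)
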